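{- If $G$ is an Eulerian graph with $n\ge 1$ non-isolated vertices and maximum degree at most $4$, then $\mathrm{cn}(G)\le\lfloor (n-1)/2\rfloor$.
   Context: All graphs are finite and simple. A graph is Eulerian if all of its vertices have even degree (it need not be connected). A cycle decomposition of an Eulerian graph $G$ is a set of pairwise edge-disjoint cycles of $G$ that together cover $E(G)$; $\mathrm{cn}(G)$ is the minimum size of a cycle decomposition of $G$. A vertex is isolated if it has degree $0$. -}

module Defs where

open import Data.Fin.Base using (Fin)
open import Data.List.Base using (List; []; _∷_; _∷ʳ_; allFin; filter; length; zip)
open import Data.List.Membership.Propositional using (_∈_)
open import Data.List.Relation.Unary.All using (All)
open import Data.List.Relation.Unary.AllPairs using (AllPairs)
open import Data.List.Relation.Unary.Any using (Any)
open import Data.List.Relation.Unary.Unique.Propositional using (Unique)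
open import Data.Nat.Base using (ℕ; _≤_)
open import Data.Nat.Divisibility using (_∣_)
import Data.Nat.Properties as ℕ
open import Data.Product.Base using (∃-syntax; _×_; _,_; uncurry)
open import Data.Sum.Base using (_⊎_)
open import Level using (0ℓ)
open import Relation.Binary.Core using (Rel)
open import Relation.Binary.Definitions using (Decidable; Irreflexive; Symmetric)
open import Relation.Binary.PropositionalEquality.Core using (_≡_)
open import Relation.Nullary.Decidable using (¬?)
open import Relation.Nullary.Negation using (¬_)
import Relation.Unary as Unary

record Graph (v : ℕ) : Set₁ where
  field
    Adj    : Rel (Fin v) 0ℓ
    adj?   : Decidable Adj
    sym    : Symmetric Adj
    irrefl : Irreflexive _≡_ Adj

module _ {v : ℕ} (G : Graph v) where
  open Graph G

  degree : Fin v → ℕ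
  degree x = length (filter (adj? x) (allFin v))

  Eulerian : Set
  Eulerian = ∀ x → 2 ∣ degree x

  MaxDegree≤ : ℕ → Set
  MaxDegree≤ d = ∀ x → degree x ≤ d

  Isolated : Fin v → Set
  Isolated x = degree x ≡ 0

  isolated? : Unary.Decidable Isolated
  isolated? x = degree x ℕ.≟ 0

  #nonIsolated : ℕ
  #nonIsolated = length (filter (λ x → ¬? (isolated? x)) (allFin v))

-- The pairs (x₁,x₂), (x₂,x₃), …, (xₖ,x₁) for the list x₁, …, xₖ.
cyclicPairs : {A : Set} → List A → List (A × A)
cyclicPairs []       = []
cyclicPairs (x ∷ xs) = zip (x ∷ xs) (xs ∷ʳ x)

-- A cycle is presented by a cyclic enumeration of its vertices.  Rotations and
-- reversals of the enumeration present the same subgraph; only the edge set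
-- (`HasEdge`) is used below.
record Cycle {v : ℕ} (G : Graph v) : Set where
  field
    vertices : List (Fin v)
    distinct : Unique vertices
    length≥3 : 3 ≤ length vertices
    adjacent : All (uncurry (Graph.Adj G)) (cyclicPairs vertices)

module _ {v : ℕ} {G : Graph v} where
  HasEdge : Fin v → Fin v → Cycle G → Set
  HasEdge x y C = (x , y) ∈ cyclicPairs (Cycle.vertices C)
                ⊎ (y , x) ∈ cyclicPairs (Cycle.vertices C)

  EdgeDisjoint : Rel (Cycle G) 0ℓ
  EdgeDisjoint C D = ∀ x y → HasEdge x y C → ¬ HasEdge x y D

-- Every cycle has an edge, so pairwise edge-disjointness already forces the
-- listed cycles to be distinct: the length of the list is the size of the set.
record IsCycleDecomposition {v : ℕ} (G : Graph v) (Cs : List (Cycle G)) : Set where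
  field
    disjoint : AllPairs EdgeDisjoint Cs
    covers   : ∀ x y → Graph.Adj G x y → Any (HasEdge x y) Cs

-- `IsCn G k` says that cn(G) is defined and equal to k.
record IsCn {v : ℕ} (G : Graph v) (k : ℕ) : Set where
  field
    attained : ∃[ Cs ] (IsCycleDecomposition G Cs × length Cs ≡ k)
    minimal  : ∀ Cs → IsCycleDecomposition G Cs → k ≤ length Cs

{-# OPTIONS --safe #-}

-- Remove a cycle C having consecutive vertices u and v such that, in G ∖ C, each of u and v is
-- isolated or has two non-adjacent neighbours, and these two pairs of neighbours are different.
-- Suppressing u and v in G ∖ C then leaves a simple Eulerian graph with at least two fewer
-- non-isolated vertices.  A cycle decomposition of it lifts to G ∖ C by subdividing edges, so one
-- cycle pays for two vertices.
--
-- Such a C is found by a greedy walk.  After entering v from u, leave v so that the two unused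
-- neighbours of v are non-adjacent and are not exactly the two unused neighbours of u; when the
-- walk first meets itself, its last two vertices serve as u and v.  The walk can only get stuck
-- at v if v lies in a K₄ or is the centre of a wheel with four spokes, and there C is chosen
-- among the cycles of length 4, 5 and 6 by comparing the neighbours outside the K₄ or the wheel.
module Submission where

import Data.Fin.Properties as Fin
import Data.List.Membership.DecPropositional as DecMembership
import Data.List.Relation.Binary.Permutation.Setoid.Properties as Permutation
import Data.List.Relation.Unary.All.Properties as All
import Data.List.Relation.Unary.AllPairs.Properties as AllPairs
import Data.List.Relation.Unary.Any.Properties as Any
import Data.List.Relation.Unary.Unique.Propositional.Properties as Unique
import Data.Nat.Properties as ℕ
open import Data.Bool.Base using (if_then_else_)
open import Data.Empty using (⊥; ⊥-elim)
open import Data.Fin.Base using (Fin)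
open import Data.List.Base
  using (List; []; _∷_; _∷ʳ_; _++_; [_]; allFin; cartesianProductWith; concatMap; filter; length; map; take; zip)
open import Data.List.Extrema ℕ.≤-totalOrder using (argmin; argmin-all; f[argmin]≤f[⊤]; f[argmin]≤f[xs])
open import Data.List.Membership.Propositional using (_∈_; _∉_; find; lose)
open import Data.List.Membership.Propositional.Properties
  using ( ∈-allFin; ∈-cartesianProductWith⁺; ∈-concatMap⁺; ∈-concatMap⁻; ∈-filter⁺; ∈-filter⁻
        ; ∈-length; ∈-∃++; ∈-++⁺ˡ; ∈-++⁺ʳ; ∈-++⁻ )
open import Data.List.Properties using (filter-notAll; length-map; length-tabulate)
open import Data.List.Relation.Binary.Permutation.Propositional
  using (_↭_; ↭-refl; ↭-trans; ↭-sym; ↭-reflexive; prep; swap; ↭⇒↭ₛ)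
open import Data.List.Relation.Binary.Permutation.Propositional.Properties
  using (∈-resp-↭; ↭-length; shift; shifts; ++⁺ˡ; ++⁺ʳ; ++-comm)
open import Data.List.Relation.Binary.Subset.Propositional using (_⊆_)
open import Data.List.Relation.Unary.All as All using (All; []; _∷_)
open import Data.List.Relation.Unary.All.Properties using (¬Any⇒All¬; All¬⇒¬Any; ¬All⇒Any¬; all-filter)
open import Data.List.Relation.Unary.AllPairs as AllPairs using (AllPairs; []; _∷_)
open import Data.List.Relation.Unary.Any as Any using (Any; here; there)
open import Data.List.Relation.Unary.Unique.Propositional using (Unique)
open import Data.Nat.Base using (ℕ; zero; suc; _+_; _*_; _∸_; _≤_; _<_; ⌊_/2⌋; z≤n; s≤s; >-nonZero)
open import Data.Nat.Divisibility using (_∣_; divides; _∣?_; m∣m*n; ∣m+n∣m⇒∣n; ∣m∣n⇒∣m+n; ∣⇒≤)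
open import Data.Nat.Tactic.RingSolver using (solve-∀)
open import Data.Product.Base as Product using (∃-syntax; _×_; _,_; proj₁; proj₂; uncurry)
open import Data.Product.Properties using (≡-dec)
open import Data.Sum.Base as Sum using (_⊎_; inj₁; inj₂)
open import Defs
open import Function.Base using (_∘_; case_of_; id)
open import Relation.Binary.Definitions using (DecidableEquality)
open import Relation.Binary.PropositionalEquality
  using (_≡_; _≢_; refl; sym; trans; cong; subst; setoid)
open import Relation.Nullary using (¬_; Dec; does; yes; no; contradiction)
open import Relation.Nullary.Decidable using (from-no; ¬?; _×-dec_; _⊎-dec_; _→-dec_)

-- Lists without repetition

private
  variable
    A : Set

Unique-resp-↭ : {xs ys : List A} → xs ↭ ys → Unique xs → Unique ys
Unique-resp-↭ p = Permutation.Unique-resp-↭ (setoid _) (↭⇒↭ₛ p)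

∉⇒All≢ : {x : A} {xs : List A} → x ∉ xs → All (x ≢_) xs
∉⇒All≢ = ¬Any⇒All¬ _

head∉tail : {x : A} {xs : List A} → Unique (x ∷ xs) → x ∉ xs
head∉tail (x∉xs ∷ _) = All¬⇒¬Any x∉xs

∈⇒↭ : {x : A} {xs : List A} → x ∈ xs → ∃[ ys ] xs ↭ x ∷ ys
∈⇒↭ x∈xs with as , bs , refl ← ∈-∃++ x∈xs = as ++ bs , shift _ as bs

unique-⊆⇒length≤ : {xs ys : List A} → Unique xs → xs ⊆ ys → length xs ≤ length ys
unique-⊆⇒length≤ {xs = []}     _ _ = z≤n
unique-⊆⇒length≤ {xs = x ∷ xs} {ys} uq@(_ ∷ uxs) xs⊆ys with zs , p ← ∈⇒↭ (xs⊆ys (here refl)) =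
  ℕ.≤-trans (s≤s (unique-⊆⇒length≤ uxs xs⊆zs)) (ℕ.≤-reflexive (sym (↭-length p)))
  where
  xs⊆zs : xs ⊆ zs
  xs⊆zs y∈xs with ∈-resp-↭ p (xs⊆ys (there y∈xs))
  ... | here refl = contradiction y∈xs (head∉tail uq)
  ... | there y∈zs = y∈zs

-- Edges of paths and closed walks

module _ {A : Set} where

  -- An edge set is stored with one orientation per edge, and `arcs` supplies both. Thus
  -- `Unique (arcs es)` rules out loops as well as edges repeated in the same or the opposite
  -- direction.
  arcs : List (A × A) → List (A × A)
  arcs []       = []
  arcs (e ∷ es) = e ∷ Product.swap e ∷ arcs es

  steps : List A → List (A × A)
  steps []           = []
  steps (x ∷ [])     = []
  steps (x ∷ y ∷ ys) = (x , y) ∷ steps (y ∷ ys)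

  arcs-↭ : ∀ {es fs} → es ↭ fs → arcs es ↭ arcs fs
  arcs-↭ _↭_.refl        = ↭-refl
  arcs-↭ (prep e p)      = prep _ (prep _ (arcs-↭ p))
  arcs-↭ (swap e f p)    =
    ↭-trans (++⁺ˡ (e ∷ Product.swap e ∷ []) (++⁺ˡ (f ∷ Product.swap f ∷ []) (arcs-↭ p)))
            (++⁺ʳ _ (++-comm (e ∷ Product.swap e ∷ []) (f ∷ Product.swap f ∷ [])))
  arcs-↭ (_↭_.trans p q) = ↭-trans (arcs-↭ p) (arcs-↭ q)

  arcs-++ : ∀ es fs → arcs (es ++ fs) ≡ arcs es ++ arcs fs
  arcs-++ []       fs = refl
  arcs-++ (e ∷ es) fs = cong (λ L → e ∷ Product.swap e ∷ L) (arcs-++ es fs)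

  arcs-swap : ∀ {x y} es → (x , y) ∈ arcs es → (y , x) ∈ arcs es
  arcs-swap (e ∷ es) (here refl)         = there (here refl)
  arcs-swap (e ∷ es) (there (here refl)) = here refl
  arcs-swap (e ∷ es) (there (there xy))  = there (there (arcs-swap es xy))

  ∈-arcs⁺ : ∀ {e} es → e ∈ es → e ∈ arcs es
  ∈-arcs⁺ (_ ∷ es) (here refl) = here refl
  ∈-arcs⁺ (_ ∷ es) (there e∈)  = there (there (∈-arcs⁺ es e∈))

  ∈-arcs⁻ : ∀ {x y} es → (x , y) ∈ arcs es → (x , y) ∈ es ⊎ (y , x) ∈ es
  ∈-arcs⁻ (_ ∷ es) (here refl)         = inj₁ (here refl)
  ∈-arcs⁻ (_ ∷ es) (there (here refl)) = inj₂ (here refl)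
  ∈-arcs⁻ (_ ∷ es) (there (there xy))  = Sum.map there there (∈-arcs⁻ es xy)

  steps-endpoints : ∀ {x y} l → (x , y) ∈ arcs (steps l) → x ∈ l
  steps-endpoints (_ ∷ _ ∷ _) (here refl)         = here refl
  steps-endpoints (_ ∷ _ ∷ _) (there (here refl)) = there (here refl)
  steps-endpoints (_ ∷ y ∷ l) (there (there xy))  = there (steps-endpoints (y ∷ l) xy)

  unique-steps : ∀ l → Unique l → Unique (arcs (steps l))
  unique-steps []      _ = []
  unique-steps (_ ∷ []) _ = []
  unique-steps (x ∷ y ∷ l) uq@((x≢y ∷ _) ∷ ul) =
      ((λ { refl → x≢y refl }) ∷ ∉⇒All≢ (λ xy → head∉tail uq (steps-endpoints (y ∷ l) xy)))
    ∷ ∉⇒All≢ (λ yx → head∉tail uq (steps-endpoints (y ∷ l) (arcs-swap (steps (y ∷ l)) yx)))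
    ∷ unique-steps (y ∷ l) ul

  cyclicPairs-steps : ∀ x xs → cyclicPairs (x ∷ xs) ≡ steps (x ∷ xs ∷ʳ x)
  cyclicPairs-steps x xs = go x xs x
    where
    go : ∀ x xs z → zip (x ∷ xs) (xs ∷ʳ z) ≡ steps (x ∷ xs ∷ʳ z)
    go x []       z = refl
    go x (y ∷ ys) z = cong ((x , y) ∷_) (go y ys z)

  unique-∷ʳ : ∀ {x : A} {xs} → Unique (x ∷ xs) → Unique (xs ∷ʳ x)
  unique-∷ʳ {x} {xs} = Unique-resp-↭ (++-comm [ x ] xs)

  -- All edges but the first form a path through distinct vertices from `y` to `x`. Its only edge at
  -- `y` goes to `z`, and `z` is not `x`, so the first edge is not among them.
  unique-cycle : ∀ x y z zs → Unique (x ∷ y ∷ z ∷ zs) → Unique (arcs (steps (x ∷ y ∷ z ∷ zs ∷ʳ x)))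
  unique-cycle x y z zs uq@((x≢y ∷ x≢z ∷ _) ∷ _) with unique-∷ʳ uq
  ... | uq′ = ((λ { refl → x≢y refl }) ∷ ∉⇒All≢ (xy∉ ∘ arcs-swap path))
            ∷ ∉⇒All≢ xy∉
            ∷ unique-steps _ uq′
    where
    path = steps (y ∷ z ∷ zs ∷ʳ x)
    xy∉ : (y , x) ∉ arcs path
    xy∉ (here refl) = x≢z refl
    xy∉ (there (here refl)) = x≢y refl
    xy∉ (there (there yx)) = head∉tail uq′ (steps-endpoints (z ∷ zs ∷ʳ x) yx)

  -- This is edge subdivision; `es` collects the untouched edges. The ends `x` and `z` stay in
  -- place, so a closed walk remains closed.
  steps-insert : ∀ {a b} u x xs z → (a , b) ∈ steps (x ∷ xs ∷ʳ z) →
    ∃[ xs′ ] ∃[ es ] (xs′ ↭ u ∷ xs × steps (x ∷ xs ∷ʳ z) ↭ (a , b) ∷ es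
                    × steps (x ∷ xs′ ∷ʳ z) ↭ (a , u) ∷ (u , b) ∷ es)
  steps-insert u x [] z (here refl) = u ∷ [] , [] , ↭-refl , ↭-refl , ↭-refl
  steps-insert u x (y ∷ ys) z (here refl) = u ∷ y ∷ ys , steps (y ∷ ys ∷ʳ z) , ↭-refl , ↭-refl , ↭-refl
  steps-insert u x (y ∷ ys) z (there ab) with ys′ , es , p , q , r ← steps-insert u y ys z ab =
      y ∷ ys′ , (x , y) ∷ es
    , ↭-trans (prep y p) (swap y u ↭-refl)
    , ↭-trans (prep _ q) (swap _ _ ↭-refl)
    , ↭-trans (prep _ r) (↭-sym (shift _ (_ ∷ _ ∷ []) es))

  steps-out : ∀ {x : A} {xs} z → x ∈ xs → ∃[ y ] (x , y) ∈ steps (xs ∷ʳ z)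
  steps-out {xs = x ∷ []}     z (here refl) = z , here refl
  steps-out {xs = x ∷ y ∷ ys} z (here refl) = y , here refl
  steps-out {xs = x ∷ y ∷ ys} z (there x∈)  = Product.map₂ there (steps-out z x∈)

module _ {A : Set} where

  replace : ∀ {u : A} {l} → u ∈ l → A → List A
  replace u∈l b = b ∷ proj₁ (∈⇒↭ u∈l)

  module _ {u : A} {l : List A} (u∈l : u ∈ l) (b : A) where

    private
      rest↭ : l ↭ u ∷ proj₁ (∈⇒↭ u∈l)
      rest↭ = proj₂ (∈⇒↭ u∈l)

    length-replace : length (replace u∈l b) ≡ length l
    length-replace = sym (↭-length rest↭)

    unique-replace : Unique l → b ∉ l → Unique (replace u∈l b)
    unique-replace ul b∉l with _ ∷ ur ← Unique-resp-↭ rest↭ ul =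
      ∉⇒All≢ (λ b∈ → b∉l (∈-resp-↭ (↭-sym rest↭) (there b∈))) ∷ ur

    ∈-replace⁺ : ∀ {y} → y ∈ l → y ≢ u → y ∈ replace u∈l b
    ∈-replace⁺ y∈l y≢u with ∈-resp-↭ rest↭ y∈l
    ... | here y≡u = contradiction y≡u y≢u
    ... | there y∈ = there y∈

    ∈-replace⁻ : ∀ {y} → Unique l → y ∈ replace u∈l b → y ≡ b ⊎ (y ∈ l × y ≢ u)
    ∈-replace⁻ ul (here y≡b) = inj₁ y≡b
    ∈-replace⁻ ul (there y∈) = inj₂
      (∈-resp-↭ (↭-sym rest↭) (there y∈) , λ { refl → head∉tail (Unique-resp-↭ rest↭ ul) y∈ })

-- Cycles as vertex lists, graphs as neighbour lists

module _ {A : Set} where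

  IsCyclicList : List A → Set
  IsCyclicList C = Unique C × 3 ≤ length C

  edges : List (List A) → List (A × A)
  edges = concatMap cyclicPairs

  -- Only the cycle through the subdivided edge changes. Since `u` lies on none of the cycles, the
  -- lengthened one still has distinct vertices.
  edges-insert : ∀ {a b} u Cs → All IsCyclicList Cs → All (u ∉_) Cs → (a , b) ∈ edges Cs →
    ∃[ Cs′ ] ∃[ es ] (length Cs′ ≡ length Cs × All IsCyclicList Cs′
                    × edges Cs ↭ (a , b) ∷ es × edges Cs′ ↭ (a , u) ∷ (u , b) ∷ es)
  edges-insert u (C ∷ Cs) (_ ∷ _) (_ ∷ _) ab∈ with ∈-++⁻ (cyclicPairs C) ab∈
  edges-insert u ((x ∷ xs) ∷ Cs) ((uq , 3≤) ∷ valid) (u∉C ∷ _) _ | inj₁ ab∈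
    rewrite cyclicPairs-steps x xs
    with xs′ , es , p , q , r ← steps-insert u x xs x ab∈ =
      (x ∷ xs′) ∷ Cs , es ++ edges Cs , refl
    , ( Unique-resp-↭ (↭-trans (swap u x ↭-refl) (prep x (↭-sym p))) (∉⇒All≢ u∉C ∷ uq)
      , ℕ.≤-trans 3≤ (s≤s (ℕ.≤-trans (ℕ.n≤1+n _) (ℕ.≤-reflexive (sym (↭-length p))))) ) ∷ valid
    , ++⁺ʳ (edges Cs) q
    , ↭-trans (↭-reflexive (cong (_++ edges Cs) (cyclicPairs-steps x xs′))) (++⁺ʳ (edges Cs) r)
  edges-insert u (C ∷ Cs) (vC ∷ valid) (_ ∷ u∉Cs) _ | inj₂ ab∈
    with Cs′ , es , l , valid′ , q , r ← edges-insert u Cs valid u∉Cs ab∈ =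
      C ∷ Cs′ , cyclicPairs C ++ es , cong suc l , vC ∷ valid′
    , ↭-trans (++⁺ˡ (cyclicPairs C) q) (shift _ (cyclicPairs C) es)
    , ↭-trans (++⁺ˡ (cyclicPairs C) r) (shifts (cyclicPairs C) (_ ∷ _ ∷ []))

  edges-out : ∀ {x} Cs → Any (x ∈_) Cs → ∃[ y ] (x , y) ∈ edges Cs
  edges-out ((a ∷ as) ∷ Cs) (here x∈)
    with y , xy∈ ← steps-out a x∈ =
    y , ∈-++⁺ˡ (subst (_ ∈_) (sym (cyclicPairs-steps a as)) xy∈)
  edges-out (C ∷ Cs) (there x∈) = Product.map₂ (∈-++⁺ʳ (cyclicPairs C)) (edges-out Cs x∈)

-- Vertices are never deleted: removing edges or suppressing a vertex keeps the type `A` and changes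
-- only the neighbour lists, a suppressed vertex being left isolated.
record QuarticGraph (A : Set) : Set where
  field
    N         : A → List A
    symmetric : ∀ {x y} → y ∈ N x → x ∈ N y
    irrefl    : ∀ {x} → x ∉ N x
    unique    : ∀ x → Unique (N x)
    even      : ∀ x → 2 ∣ length (N x)
    ≤4        : ∀ x → length (N x) ≤ 4

  adjacent⇒≢ : ∀ {x y} → y ∈ N x → x ≢ y
  adjacent⇒≢ y∈ refl = irrefl y∈

-- Edge-disjointness is encoded as the absence of repetition in the list of all arcs, a condition
-- that passes through permutations of the edges.
record Decomposes {A : Set} (H : QuarticGraph A) (Cs : List (List A)) : Set where
  open QuarticGraph H using (N)
  field
    cyclic       : All IsCyclicList Cs
    unique-edges : Unique (arcs (edges Cs))
    sound        : ∀ {x y} → (x , y) ∈ arcs (edges Cs) → y ∈ N x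
    complete     : ∀ {x y} → y ∈ N x → (x , y) ∈ arcs (edges Cs)

-- `S` contains the non-isolated vertices and possibly others; its length plays the part of n in the
-- bound and in the induction.
Covers : {A : Set} → List A → QuarticGraph A → Set
Covers S H = ∀ {x y} → y ∈ QuarticGraph.N H x → x ∈ S

-- `u` and `v` can be suppressed once the cycle u, v, w, … has been removed.
record Reducible {A : Set} (H : QuarticGraph A) : Set where
  open QuarticGraph H using (N)
  field
    {u v w} : A
    rest    : List A

  cycle : List (A × A)
  cycle = steps (u ∷ v ∷ w ∷ rest ∷ʳ u)

  Off : A → A → Set
  Off x y = y ∈ N x × (x , y) ∉ arcs cycle

  field
    distinct : Unique (u ∷ v ∷ w ∷ rest)
    adjacent : ∀ {x y} → (x , y) ∈ arcs cycle → y ∈ N x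
    apart-u  : ∀ {a b} → Off u a → Off u b → ¬ Off a b
    apart-v  : ∀ {a b} → Off v a → Off v b → ¬ Off a b
    differ   : ∀ {a b} → a ≢ b → Off u a → Off u b → Off v a → ¬ Off v b

module _ {A : Set} (_≟_ : DecidableEquality A) where

  open DecMembership _≟_ using (_∈?_)
  open DecMembership (≡-dec _≟_ _≟_) using () renaming (_∈?_ to _∈²?_)
  open QuarticGraph

  unique-saturated : ∀ {xs ys : List A} → Unique xs → xs ⊆ ys → length ys ≤ length xs → ys ⊆ xs
  unique-saturated {xs} {ys} uxs xs⊆ys ys≤xs {y} y∈ys with y ∈? xs
  ... | yes y∈xs = y∈xs
  ... | no  y∉xs = contradiction ys≤xs (ℕ.<⇒≱ (unique-⊆⇒length≤ {xs = y ∷ xs} (∉⇒All≢ y∉xs ∷ uxs)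
                     λ { (here refl) → y∈ys ; (there z∈) → xs⊆ys z∈ }))

  -- Degree parity along walks

  out : A → List (A × A) → List A
  out x []            = []
  out x ((a , b) ∷ L) = if does (x ≟ a) then b ∷ out x L else out x L

  ∈-out⁺ : ∀ {x y} L → (x , y) ∈ L → y ∈ out x L
  ∈-out⁺ {x} ((a , _) ∷ L) xy∈ with x ≟ a | xy∈
  ... | yes _   | here refl = here refl
  ... | yes _   | there xy  = there (∈-out⁺ L xy)
  ... | no x≢a  | here refl = contradiction refl x≢a
  ... | no _    | there xy  = ∈-out⁺ L xy

  ∈-out⁻ : ∀ {x y} L → y ∈ out x L → (x , y) ∈ L
  ∈-out⁻ {x} ((a , _) ∷ L) y∈ with x ≟ a | y∈
  ... | yes refl | here refl = here refl
  ... | yes _    | there y∈′ = there (∈-out⁻ L y∈′)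
  ... | no _     | y∈′       = there (∈-out⁻ L y∈′)

  unique-out : ∀ x L → Unique L → Unique (out x L)
  unique-out x [] _ = []
  unique-out x ((a , _) ∷ L) uq@(_ ∷ uL) with x ≟ a
  ... | yes refl = ∉⇒All≢ (λ y∈ → head∉tail uq (∈-out⁻ L y∈)) ∷ unique-out x L uL
  ... | no _     = unique-out x L uL

  at : A → A → ℕ
  at x a = if does (x ≟ a) then 1 else 0

  length-out-∷ : ∀ x a b L → length (out x ((a , b) ∷ L)) ≡ at x a + length (out x L)
  length-out-∷ x a b L with x ≟ a
  ... | yes _ = refl
  ... | no _  = refl

  -- A walk uses two edges per visit to a vertex, except that its two ends lack one each.
  steps-parity : ∀ x a xs z → 2 ∣ length (out x (arcs (steps (a ∷ xs ∷ʳ z)))) + (at x a + at x z)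
  steps-parity x a [] z rewrite length-out-∷ x a z ((z , a) ∷ []) | length-out-∷ x z a [] =
    subst (2 ∣_) (eq (at x a) (at x z)) (m∣m*n (at x a + at x z))
    where
    eq : ∀ p q → 2 * (p + q) ≡ p + (q + 0) + (p + q)
    eq = solve-∀
  steps-parity x a (y ∷ ys) z
    rewrite length-out-∷ x a y ((y , a) ∷ arcs (steps (y ∷ ys ∷ʳ z)))
          | length-out-∷ x y a (arcs (steps (y ∷ ys ∷ʳ z))) =
    subst (2 ∣_) (eq (at x a) (length (out x (arcs (steps (y ∷ ys ∷ʳ z))))) (at x y) (at x z))
        (∣m∣n⇒∣m+n (m∣m*n (at x a)) (steps-parity x y ys z))
    where
    eq : ∀ p o q r → 2 * p + (o + (q + r)) ≡ p + (q + o) + (p + r)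
    eq = solve-∀

  -- The two ends of a closed walk coincide, so the edges they lack add up to an even number at
  -- every vertex.
  cycle-parity : ∀ x a xs → 2 ∣ length (out x (arcs (steps (a ∷ xs ∷ʳ a))))
  cycle-parity x a xs = ∣m+n∣m⇒∣n
    (subst (2 ∣_) (eq (length (out x (arcs (steps (a ∷ xs ∷ʳ a))))) (at x a)) (steps-parity x a xs a))
    (m∣m*n (at x a))
    where
    eq : ∀ o p → o + (p + p) ≡ 2 * p + o
    eq = solve-∀

  -- Removal of an edge set with even degrees

  module Removal (H : QuarticGraph A) (es : List (A × A)) (ues : Unique (arcs es))
                 (es⊆H : ∀ {x y} → (x , y) ∈ arcs es → y ∈ N H x)
                 (parity : ∀ x → 2 ∣ length (out x (arcs es))) where

    private
      on : ∀ x y → Dec ((x , y) ∈ arcs es)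
      on x y = (x , y) ∈²? arcs es

      length-partition : ∀ x l → length (filter (on x) l) + length (filter (¬? ∘ on x) l) ≡ length l
      length-partition x [] = refl
      length-partition x (y ∷ l) with on x y
      ... | yes _ = cong suc (length-partition x l)
      ... | no _  = trans (ℕ.+-suc _ _) (cong suc (length-partition x l))

      length-on : ∀ x → length (filter (on x) (N H x)) ≡ length (out x (arcs es))
      length-on x = ℕ.≤-antisym
        (unique-⊆⇒length≤ (Unique.filter⁺ (on x) (unique H x))
          (λ y∈ → ∈-out⁺ _ (proj₂ (∈-filter⁻ (on x) {xs = N H x} y∈))))
        (unique-⊆⇒length≤ (unique-out x _ ues)
          (λ y∈ → let xy∈ = ∈-out⁻ _ y∈ in ∈-filter⁺ (on x) (es⊆H xy∈) xy∈))

    N′ : A → List A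
    N′ x = filter (¬? ∘ on x) (N H x)

    ∈-N′⁺ : ∀ {x y} → y ∈ N H x → (x , y) ∉ arcs es → y ∈ N′ x
    ∈-N′⁺ = ∈-filter⁺ (¬? ∘ on _)

    ∈-N′⁻ : ∀ {x y} → y ∈ N′ x → y ∈ N H x × (x , y) ∉ arcs es
    ∈-N′⁻ {x} = ∈-filter⁻ (¬? ∘ on x)

    length-N′ : ∀ x → length (out x (arcs es)) + length (N′ x) ≡ length (N H x)
    length-N′ x = trans (cong (_+ length (N′ x)) (sym (length-on x))) (length-partition x (N H x))

    remove : QuarticGraph A
    remove = record
      { N         = N′
      ; symmetric = λ y∈ → let yx , ∉es = ∈-N′⁻ y∈ in ∈-N′⁺ (symmetric H yx) (∉es ∘ arcs-swap es)
      ; irrefl    = λ x∈ → irrefl H (proj₁ (∈-N′⁻ x∈))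
      ; unique    = λ x → Unique.filter⁺ (¬? ∘ on x) (unique H x)
      ; even      = λ x → ∣m+n∣m⇒∣n (subst (2 ∣_) (sym (length-N′ x)) (even H x)) (parity x)
      ; ≤4        = λ x → ℕ.≤-trans (ℕ.m+n≤o⇒n≤o _ (ℕ.≤-reflexive (length-N′ x))) (≤4 H x)
      }

    restore : ∀ {Cs} C → IsCyclicList C → cyclicPairs C ≡ es → Decomposes remove Cs → Decomposes H (C ∷ Cs)
    restore {Cs} C vC refl D = record
      { cyclic       = vC ∷ Decomposes.cyclic D
      ; unique-edges = subst Unique (sym split) (Unique.++⁺ ues (Decomposes.unique-edges D)
                         λ { (e∈C , e∈Cs) → proj₂ (∈-N′⁻ (Decomposes.sound D e∈Cs)) e∈C })
      ; sound        = λ xy∈ → Sum.[ es⊆H , proj₁ ∘ ∈-N′⁻ ∘ Decomposes.sound D ]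
                         (∈-++⁻ (arcs es) (subst (_ ∈_) split xy∈))
      ; complete     = complete′
      }
      where
      split : arcs (edges (C ∷ Cs)) ≡ arcs es ++ arcs (edges Cs)
      split = arcs-++ es (edges Cs)
      complete′ : ∀ {x y} → y ∈ N H x → (x , y) ∈ arcs (edges (C ∷ Cs))
      complete′ {x} {y} y∈ with on x y
      ... | yes xy∈ = subst (_ ∈_) (sym split) (∈-++⁺ˡ xy∈)
      ... | no  xy∉ = subst (_ ∈_) (sym split) (∈-++⁺ʳ (arcs es) (Decomposes.complete D (∈-N′⁺ y∈ xy∉)))

  -- Suppression of a vertex of degree two

  module Suppression (H : QuarticGraph A) {u a b : A} (Nu : N H u ≡ a ∷ b ∷ []) (b∉Na : b ∉ N H a) where

    a∈Nu : a ∈ N H u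
    a∈Nu = subst (a ∈_) (sym Nu) (here refl)

    b∈Nu : b ∈ N H u
    b∈Nu = subst (b ∈_) (sym Nu) (there (here refl))

    u∈Na : u ∈ N H a
    u∈Na = symmetric H a∈Nu

    u∈Nb : u ∈ N H b
    u∈Nb = symmetric H b∈Nu

    a≢b : a ≢ b
    a≢b refl with (a≢a ∷ []) ∷ _ ← subst Unique Nu (unique H u) = a≢a refl

    Nu⁻ : ∀ {x} → x ∈ N H u → x ≡ a ⊎ x ≡ b
    Nu⁻ x∈ with subst (_ ∈_) Nu x∈
    ... | here x≡a         = inj₁ x≡a
    ... | there (here x≡b) = inj₂ x≡b

    -- Adjacency once the path `a`, `u`, `b` has been replaced by an edge between `a` and `b`;
    -- `b∉Na` prevents a double edge.
    data Suppressed (x y : A) : Set where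
      kept : y ∈ N H x → x ≢ u → y ≢ u → Suppressed x y
      ab   : x ≡ a → y ≡ b → Suppressed x y
      ba   : x ≡ b → y ≡ a → Suppressed x y

    N′ : A → List A
    N′ x with x ≟ u | x ≟ a | x ≟ b
    ... | yes _ | _        | _        = []
    ... | no _  | yes refl | _        = replace u∈Na b
    ... | no _  | no _     | yes refl = replace u∈Nb a
    ... | no _  | no _     | no _     = N H x

    ∈-N′⁻ : ∀ {x y} → y ∈ N′ x → Suppressed x y
    ∈-N′⁻ {x} y∈ with x ≟ u | x ≟ a | x ≟ b
    ... | no x≢u | yes refl | _ with ∈-replace⁻ u∈Na b (unique H x) y∈
    ...   | inj₁ y≡b = ab refl y≡b
    ...   | inj₂ (y∈Na , y≢u) = kept y∈Na x≢u y≢u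
    ∈-N′⁻ {x} y∈ | no x≢u | no _ | yes refl with ∈-replace⁻ u∈Nb a (unique H x) y∈
    ...   | inj₁ y≡a = ba refl y≡a
    ...   | inj₂ (y∈Nb , y≢u) = kept y∈Nb x≢u y≢u
    ∈-N′⁻ {x} y∈ | no x≢u | no x≢a | no x≢b =
      kept y∈ x≢u λ { refl → Sum.[ x≢a , x≢b ] (Nu⁻ (symmetric H y∈)) }

    ∈-N′⁺ : ∀ {x y} → Suppressed x y → y ∈ N′ x
    ∈-N′⁺ {x} s with x ≟ u | x ≟ a | x ≟ b | s
    ... | yes refl | _        | _ | kept _ x≢u _ = contradiction refl x≢u
    ... | yes refl | _        | _ | ab refl _ = contradiction a∈Nu (irrefl H)
    ... | yes refl | _        | _ | ba refl _ = contradiction b∈Nu (irrefl H)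
    ... | no _     | yes refl | _ | kept y∈ _ y≢u = ∈-replace⁺ u∈Na b y∈ y≢u
    ... | no _     | yes refl | _ | ab _ refl = here refl
    ... | no _     | yes refl | _ | ba a≡b _ = contradiction a≡b a≢b
    ... | no _     | no x≢a | yes refl | kept y∈ _ y≢u = ∈-replace⁺ u∈Nb a y∈ y≢u
    ... | no _     | no x≢a | yes refl | ab x≡a _ = contradiction x≡a x≢a
    ... | no _     | no x≢a | yes refl | ba _ refl = here refl
    ... | no _     | no x≢a | no x≢b | kept y∈ _ _ = y∈
    ... | no _     | no x≢a | no x≢b | ab x≡a _ = contradiction x≡a x≢a
    ... | no _     | no x≢a | no x≢b | ba x≡b _ = contradiction x≡b x≢b

    -- Suppression makes the degree of `u` zero and preserves every other degree. Stated for all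
    -- `P`, this yields evenness, the bound four and the comparison with the old degrees at once.
    length-property : ∀ x (P : ℕ → Set) → P 0 → P (length (N H x)) → P (length (N′ x))
    length-property x P p0 p with x ≟ u | x ≟ a | x ≟ b
    ... | yes _ | _        | _        = p0
    ... | no _  | yes refl | _        = subst P (sym (length-replace u∈Na b)) p
    ... | no _  | no _     | yes refl = subst P (sym (length-replace u∈Nb a)) p
    ... | no _  | no _     | no _     = p

    unique-N′ : ∀ x → Unique (N′ x)
    unique-N′ x with x ≟ u | x ≟ a | x ≟ b
    ... | yes _ | _        | _        = []
    ... | no _  | yes refl | _        = unique-replace u∈Na b (unique H x) b∉Na
    ... | no _  | no _     | yes refl = unique-replace u∈Nb a (unique H x) (b∉Na ∘ symmetric H)
    ... | no _  | no _     | no _     = unique H x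

    suppress : QuarticGraph A
    suppress = record
      { N         = N′
      ; symmetric = λ y∈ → ∈-N′⁺ (flip (∈-N′⁻ y∈))
      ; irrefl    = λ x∈ → loopless (∈-N′⁻ x∈)
      ; unique    = unique-N′
      ; even      = λ x → length-property x (2 ∣_) (divides 0 refl) (even H x)
      ; ≤4        = λ x → length-property x (_≤ 4) z≤n (≤4 H x)
      }
      where
      flip : ∀ {x y} → Suppressed x y → Suppressed y x
      flip (kept y∈ x≢u y≢u) = kept (symmetric H y∈) y≢u x≢u
      flip (ab x≡a y≡b)      = ba y≡b x≡a
      flip (ba x≡b y≡a)      = ab y≡a x≡b
      loopless : ∀ {x} → ¬ Suppressed x x
      loopless (kept x∈ _ _) = irrefl H x∈
      loopless (ab refl x≡b) = a≢b x≡b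
      loopless (ba refl x≡a) = a≢b (sym x≡a)

    N′-u : ∀ {x} → x ∉ N′ u
    N′-u x∈ with ∈-N′⁻ x∈
    ... | kept _ u≢u _ = u≢u refl
    ... | ab refl _ = irrefl H a∈Nu
    ... | ba refl _ = irrefl H b∈Nu

    private
      -- The cycle through the new edge is rerouted through `u`. Here `c`, `d` are `a`, `b` in the
      -- order in which that cycle traverses them.
      unsuppress-oriented : ∀ {c d} Cs → Decomposes suppress Cs → (c , d) ∈ edges Cs →
        c ∈ N H u → d ∈ N H u → (∀ {x} → x ∈ N H u → x ≡ c ⊎ x ≡ d) → d ∉ N H c →
        (∀ {x y} → Suppressed x y → y ∈ N H x ⊎ (x , y) ∈ arcs ((c , d) ∷ [])) →
        ∃[ Cs′ ] (length Cs′ ≡ length Cs × Decomposes H Cs′)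
      unsuppress-oriented {c} {d} Cs D cd∈ c∈Nu d∈Nu Nu⁻′ d∉Nc old
        -- Every vertex on a cycle has an edge there, whereas `u` is isolated after the suppression;
        -- so `u` lies on no cycle of `Cs`.
        with Cs′ , es , l , cyclic′ , p , q ← edges-insert u Cs (Decomposes.cyclic D)
          (¬Any⇒All¬ Cs (λ u∈ → N′-u (Decomposes.sound D (∈-arcs⁺ _ (proj₂ (edges-out Cs u∈)))))) cd∈
        with P ← arcs-↭ p | Q ← arcs-↭ q
        with uP@(_ ∷ uP′@(_ ∷ ues)) ← Unique-resp-↭ P (Decomposes.unique-edges D) =
        Cs′ , l , record
          { cyclic       = cyclic′
          ; unique-edges = Unique-resp-↭ (↭-sym Q)
              -- The four new arcs meet `u` and no arc of `es` does, so only comparisons among the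
              -- four remain.
              ( ((λ { refl → u≢c refl }) ∷ (λ { refl → u≢c refl }) ∷ (λ { refl → c≢d refl }) ∷ ∉⇒All≢
                  (u∉es ∘ arcs-swap es))
              ∷ ((λ { refl → c≢d refl }) ∷ (λ { refl → u≢d refl }) ∷ ∉⇒All≢ u∉es)
              ∷ ((λ { refl → u≢d refl }) ∷ ∉⇒All≢ u∉es)
              ∷ ∉⇒All≢ (u∉es ∘ arcs-swap es)
              ∷ ues )
          ; sound    = sound′ ∘ ∈-resp-↭ Q
          ; complete = ∈-resp-↭ (↭-sym Q) ∘ complete′
          }
        where
        u≢c : u ≢ c
        u≢c = adjacent⇒≢ H c∈Nu
        u≢d : u ≢ d
        u≢d = adjacent⇒≢ H d∈Nu
        c≢d : c ≢ d
        c≢d refl = head∉tail uP (here refl)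
        suppressed : ∀ {x y} → (x , y) ∈ arcs es → Suppressed x y
        suppressed xy∈ = ∈-N′⁻ (Decomposes.sound D (∈-resp-↭ (↭-sym P) (there (there xy∈))))
        u∉es : ∀ {y} → (u , y) ∉ arcs es
        u∉es uy∈ = N′-u (∈-N′⁺ (suppressed uy∈))
        sound′ : ∀ {x y} → (x , y) ∈ arcs ((c , u) ∷ (u , d) ∷ es) → y ∈ N H x
        sound′ (here refl) = symmetric H c∈Nu
        sound′ (there (here refl)) = c∈Nu
        sound′ (there (there (here refl))) = d∈Nu
        sound′ (there (there (there (here refl)))) = symmetric H d∈Nu
        -- An arc of the suppressed graph that is not one of `H` runs between `c` and `d`, and
        -- uniqueness keeps that edge out of `es`.
        sound′ (there (there (there (there xy∈)))) with old (suppressed xy∈)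
        ... | inj₁ y∈ = y∈
        ... | inj₂ (here refl) = contradiction (there xy∈) (head∉tail uP)
        ... | inj₂ (there (here refl)) = contradiction xy∈ (head∉tail uP′)
        complete′ : ∀ {x y} → y ∈ N H x → (x , y) ∈ arcs ((c , u) ∷ (u , d) ∷ es)
        complete′ {x} {y} y∈ with x ≟ u | y ≟ u
        complete′ y∈ | yes refl | _ with Nu⁻′ y∈
        ... | inj₁ refl = there (here refl)
        ... | inj₂ refl = there (there (here refl))
        complete′ y∈ | no _ | yes refl with Nu⁻′ (symmetric H y∈)
        ... | inj₁ refl = here refl
        ... | inj₂ refl = there (there (there (here refl)))
        complete′ y∈ | no x≢u | no y≢u
          with ∈-resp-↭ P (Decomposes.complete D (∈-N′⁺ (kept y∈ x≢u y≢u)))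
        -- Subdivision destroys the edge between `c` and `d`, which loses nothing because `c` and
        -- `d` are non-adjacent in `H`.
        ... | here refl = contradiction y∈ d∉Nc
        ... | there (here refl) = contradiction (symmetric H y∈) d∉Nc
        ... | there (there xy∈) = there (there (there (there xy∈)))

    unsuppress : ∀ {Cs} → Decomposes suppress Cs → ∃[ Cs′ ] (length Cs′ ≡ length Cs × Decomposes H Cs′)
    unsuppress {Cs} D with ∈-arcs⁻ (edges Cs) (Decomposes.complete D (∈-N′⁺ (ab refl refl)))
    ... | inj₁ ab∈ = unsuppress-oriented Cs D ab∈ a∈Nu b∈Nu Nu⁻ b∉Na λ
      { (kept y∈ _ _) → inj₁ y∈ ; (ab refl refl) → inj₂ (here refl) ; (ba refl refl) → inj₂ (there (here refl)) }
    ... | inj₂ ba∈ = unsuppress-oriented Cs D ba∈ b∈Nu a∈Nu (Sum.swap ∘ Nu⁻) (b∉Na ∘ symmetric H) λ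
      { (kept y∈ _ _) → inj₁ y∈ ; (ab refl refl) → inj₂ (there (here refl)) ; (ba refl refl) → inj₂ (here refl) }

  -- Removing a cycle and eliminating two of its vertices

  _-_ : List A → A → List A
  S - u = filter (λ x → ¬? (x ≟ u)) S

  ∈-minus : ∀ {x u S} → x ∈ S → x ≢ u → x ∈ S - u
  ∈-minus = ∈-filter⁺ (λ x → ¬? (x ≟ _))

  length-minus : ∀ {u S} → u ∈ S → length (S - u) < length S
  length-minus u∈S = filter-notAll _ _ (lose u∈S λ u≢u → u≢u refl)

  -- Common interface for an isolated vertex, where nothing changes, and a vertex of degree two,
  -- which is suppressed. By `old`, a new adjacency can only join two neighbours of `u`.
  record Elimination (H : QuarticGraph A) (u : A) : Set where
    field
      H′       : QuarticGraph A
      isolated : ∀ {x} → x ∉ N H′ u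
      old      : ∀ {x y} → y ∈ N H′ x → y ∈ N H x ⊎ (x ≢ y × x ∈ N H u × y ∈ N H u)
      degree≤  : ∀ x → length (N H′ x) ≤ length (N H x)
      lift     : ∀ {Cs} → Decomposes H′ Cs → ∃[ Cs′ ] (length Cs′ ≡ length Cs × Decomposes H Cs′)

  eliminate : ∀ H u → length (N H u) ≤ 2 → (∀ {a b} → a ∈ N H u → b ∈ N H u → b ∉ N H a) → Elimination H u
  eliminate H u ≤2 apart with N H u in Nu
  ... | [] = record
    { H′ = H ; isolated = λ x∈ → case subst (_ ∈_) Nu x∈ of λ () ; old = inj₁
    ; degree≤ = λ _ → ℕ.≤-refl ; lift = λ D → _ , refl , D }
  ... | _ ∷ [] = contradiction (∣⇒≤ (subst ((2 ∣_) ∘ length) Nu (even H u))) λ { (s≤s ()) }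
  ... | a ∷ b ∷ [] = record
    { H′       = suppress
    ; isolated = N′-u
    ; old      = λ y∈ → old′ (∈-N′⁻ y∈)
    ; degree≤  = λ x → length-property x (_≤ length (N H x)) z≤n ℕ.≤-refl
    ; lift     = unsuppress
    }
    where
    open Suppression H Nu (apart (here refl) (there (here refl)))
    old′ : ∀ {x y} → Suppressed x y → y ∈ N H x ⊎ (x ≢ y × x ∈ N H u × y ∈ N H u)
    old′ (kept y∈ _ _)  = inj₁ y∈
    old′ (ab refl refl) = inj₂ (a≢b , a∈Nu , b∈Nu)
    old′ (ba refl refl) = inj₂ (a≢b ∘ sym , b∈Nu , a∈Nu)
  ... | _ ∷ _ ∷ _ ∷ _ = contradiction ≤2 λ { (s≤s (s≤s ())) }

  covers-minus : ∀ {H u S} (E : Elimination H u) → Covers S H → Covers (S - u) (Elimination.H′ E)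
  covers-minus {H} {u} {S} E cov {x} {y} y∈ = ∈-minus x∈S λ { refl → isolated y∈ }
    where
    open Elimination E
    x∈S : x ∈ S
    x∈S with old y∈
    ... | inj₁ y∈Nx = cov y∈Nx
    ... | inj₂ (_ , x∈Nu , _) = cov (symmetric H x∈Nu)

  -- `lift` pays one cycle for the two vertices gained in `smaller`; `nonempty` keeps the
  -- subtraction in the bound for `S′` from being truncated.
  record Reduction (H : QuarticGraph A) (S : List A) : Set where
    field
      H′       : QuarticGraph A
      S′       : List A
      covers   : Covers S′ H′
      nonempty : 1 ≤ length S′
      smaller  : 2 + length S′ ≤ length S
      lift     : ∀ {Cs} → Decomposes H′ Cs → ∃[ Cs′ ] (length Cs′ ≡ suc (length Cs) × Decomposes H Cs′)

  module _ {H : QuarticGraph A} (es : List (A × A)) (ues : Unique (arcs es))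
           (es⊆H : ∀ {x y} → (x , y) ∈ arcs es → y ∈ N H x)
           (parity : ∀ x → 2 ∣ length (out x (arcs es))) where

    private
      Off : A → A → Set
      Off x y = y ∈ N H x × (x , y) ∉ arcs es

    reduce-along : ∀ {S} → Covers S H → ∀ {u v w} C → IsCyclicList C → cyclicPairs C ≡ es →
      (u , v) ∈ arcs es → w ∈ S → u ≢ w → v ≢ w →
      (∀ {a b} → Off u a → Off u b → ¬ Off a b) →
      (∀ {a b} → Off v a → Off v b → ¬ Off a b) →
      (∀ {a b} → a ≢ b → Off u a → Off u b → Off v a → ¬ Off v b) →
      Reduction H S
    reduce-along {S} cov {u} {v} {w} C cyclic C≡es uv∈ w∈S u≢w v≢w apart-u apart-v differ = record
      { H′       = Elimination.H′ E₂
      ; S′       = (S - u) - v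
      ; covers   = covers-minus E₂ (covers-minus E₁ (cov ∘ proj₁ ∘ ∈-N′⁻))
      ; nonempty = ∈-length (∈-minus (∈-minus w∈S (u≢w ∘ sym)) (v≢w ∘ sym))
      ; smaller  = ℕ.≤-trans (s≤s (length-minus (∈-minus v∈S (u≢v ∘ sym)))) (length-minus u∈S)
      ; lift     = lift′
      }
      where
      open Removal H es ues es⊆H parity
      u≢v : u ≢ v
      u≢v = adjacent⇒≢ H (es⊆H uv∈)
      u∈S : u ∈ S
      u∈S = cov (es⊆H uv∈)
      v∈S : v ∈ S
      v∈S = cov (es⊆H (arcs-swap es uv∈))
      -- The number of edges of `es` at `x` is even and positive, hence at least two, out of at most
      -- four.
      degree≤2 : ∀ {x y} → (x , y) ∈ arcs es → length (N′ x) ≤ 2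
      degree≤2 {x} xy∈ = ℕ.+-cancelˡ-≤ 2 _ _ (ℕ.≤-trans (ℕ.+-monoˡ-≤ (length (N′ x)) 2≤out)
                           (ℕ.≤-trans (ℕ.≤-reflexive (length-N′ x)) (≤4 H x)))
        where
        2≤out : 2 ≤ length (out x (arcs es))
        2≤out = ∣⇒≤ ⦃ >-nonZero (∈-length (∈-out⁺ (arcs es) xy∈)) ⦄ (parity x)
      E₁ : Elimination remove u
      E₁ = eliminate remove u (degree≤2 uv∈) λ a∈ b∈ b∈Na → apart-u (∈-N′⁻ a∈) (∈-N′⁻ b∈) (∈-N′⁻ b∈Na)
      open Elimination E₁ using (old; degree≤) renaming (H′ to H₁)
      -- The edge between `u` and `v` has been removed, so `v` is no neighbour of `u` and gains none
      -- from its suppression.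
      old-v : ∀ {y} → y ∈ N H₁ v → y ∈ N′ v
      old-v y∈ with old y∈
      ... | inj₁ y∈N′v = y∈N′v
      ... | inj₂ (_ , v∈N′u , _) = contradiction uv∈ (proj₂ (∈-N′⁻ v∈N′u))
      E₂ : Elimination H₁ v
      E₂ = eliminate H₁ v (ℕ.≤-trans (degree≤ v) (degree≤2 (arcs-swap es uv∈))) apart₂
        where
        apart₂ : ∀ {a b} → a ∈ N H₁ v → b ∈ N H₁ v → b ∉ N H₁ a
        apart₂ a∈ b∈ b∈Na with old b∈Na
        ... | inj₁ b∈N′a = apart-v (∈-N′⁻ (old-v a∈)) (∈-N′⁻ (old-v b∈)) (∈-N′⁻ b∈N′a)
        ... | inj₂ (a≢b , a∈N′u , b∈N′u) =
          differ a≢b (∈-N′⁻ a∈N′u) (∈-N′⁻ b∈N′u) (∈-N′⁻ (old-v a∈)) (∈-N′⁻ (old-v b∈))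
      lift′ : ∀ {Cs} → Decomposes (Elimination.H′ E₂) Cs →
              ∃[ Cs′ ] (length Cs′ ≡ suc (length Cs) × Decomposes H Cs′)
      lift′ D with Cs₁ , l₁ , D₁ ← Elimination.lift E₂ D
              with Cs₂ , l₂ , D₂ ← Elimination.lift E₁ D₁ =
        C ∷ Cs₂ , cong suc (trans l₂ l₁) , restore C cyclic C≡es D₂

  reduce : ∀ {H S} → Covers S H → Reducible H → Reduction H S
  reduce {H} {S} cov red = reduce-along cycle (unique-cycle u v w rest distinct) adjacent
    (λ x → cycle-parity x u (v ∷ w ∷ rest)) cov
    (u ∷ v ∷ w ∷ rest) (distinct , s≤s (s≤s (s≤s z≤n))) (cyclicPairs-steps u (v ∷ w ∷ rest))
    (here refl) (cov (adjacent (there (there (there (here refl))))))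
    (λ { refl → head∉tail distinct (there (here refl)) })
    (λ { refl → head∉tail (AllPairs.tail distinct) (here refl) })
    apart-u apart-v differ
    where open Reducible red

-- Cycles at a K₄ or at a wheel with four spokes

2∤3 : ¬ 2 ∣ 3
2∤3 = from-no (2 ∣? 3)

-- Membership by position. In `arcs`, positions 2i and 2i + 1 hold the two orientations of the edge
-- at position i.
pattern #0 = here refl
pattern #1 = there #0
pattern #2 = there #1
pattern #3 = there #2
pattern #4 = there #3
pattern #5 = there #4
pattern #6 = there #5
pattern #7 = there #6
pattern #8 = there #7
pattern #9 = there #8

module _ {A : Set} (_≟_ : DecidableEquality A) (H : QuarticGraph A) where

  open DecMembership _≟_ using (_∈?_)
  open QuarticGraph H

  private
    infix 4 _~_ _~?_

    _~_ : A → A → Set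
    x ~ y = y ∈ N x

    _~?_ : ∀ x y → Dec (x ~ y)
    x ~? y = y ∈? N x

    four-neighbours : ∀ {x a b c d} → Unique (a ∷ b ∷ c ∷ d ∷ []) → x ~ a → x ~ b → x ~ c → x ~ d →
      ∀ {y} → x ~ y → y ∈ a ∷ b ∷ c ∷ d ∷ []
    four-neighbours {x} u xa xb xc xd = unique-saturated _≟_ u
      (λ { #0 → xa ; #1 → xb ; #2 → xc ; #3 → xd }) (≤4 x)

    -- A degree of exactly three would be odd.
    fourth-neighbour : ∀ {x a b c} → Unique (a ∷ b ∷ c ∷ []) → x ~ a → x ~ b → x ~ c →
      ∃[ d ] (x ~ d × d ≢ a × d ≢ b × d ≢ c)
    fourth-neighbour {x} {a} {b} {c} u xa xb xc with All.all? (_∈? (a ∷ b ∷ c ∷ [])) (N x)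
    ... | yes all = contradiction (subst (2 ∣_) three (even x)) 2∤3
      where
      three : length (N x) ≡ 3
      three = ℕ.≤-antisym (unique-⊆⇒length≤ (unique x) (All.lookup all))
                          (unique-⊆⇒length≤ u λ { #0 → xa ; #1 → xb ; #2 → xc })
    ... | no ¬all with d , xd , d∉ ← find (¬All⇒Any¬ (_∈? _) (N x) ¬all) =
      d , xd , (λ { refl → d∉ #0 }) , (λ { refl → d∉ #1 }) , (λ { refl → d∉ #2 })

    arcs-adjacent : ∀ {es} → All (uncurry _~_) es → ∀ {x y} → (x , y) ∈ arcs es → x ~ y
    arcs-adjacent all xy∈ with ∈-arcs⁻ _ xy∈
    ... | inj₁ xy = All.lookup all xy
    ... | inj₂ yx = symmetric (All.lookup all yx)

    module _ (u v w : A) (rest : List A) where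

      Off : A → A → Set
      Off x y = x ~ y × (x , y) ∉ arcs (steps (u ∷ v ∷ w ∷ rest ∷ʳ u))

      -- Since `Off` is relative to the cycle, `a` and `b` may be adjacent in `H` as long as the
      -- cycle uses that edge; likewise `c` and `d`. The two pairs differ because `a` occurs only in
      -- the first.
      reducible-pairs : Unique (u ∷ v ∷ w ∷ rest) → All (uncurry _~_) (steps (u ∷ v ∷ w ∷ rest ∷ʳ u)) →
        ∀ a b c d → (∀ {x} → Off u x → x ≡ a ⊎ x ≡ b) → ¬ Off a b →
        (∀ {x} → Off v x → x ≡ c ⊎ x ≡ d) → ¬ Off c d → a ≢ c → a ≢ d → Reducible H
      reducible-pairs uq adj a b c d only-ab ¬ab only-cd ¬cd a≢c a≢d = record
        { rest = rest ; distinct = uq ; adjacent = arcs-adjacent adj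
        ; apart-u = apart only-ab ¬ab ; apart-v = apart only-cd ¬cd ; differ = differ }
        where
        apart : ∀ {s a b} → (∀ {x} → Off s x → x ≡ a ⊎ x ≡ b) → ¬ Off a b →
                ∀ {x y} → Off s x → Off s y → ¬ Off x y
        apart only ¬ab sx sy (xy , xy∉) with only sx | only sy
        ... | inj₁ refl | inj₁ refl = irrefl xy
        ... | inj₁ refl | inj₂ refl = ¬ab (xy , xy∉)
        ... | inj₂ refl | inj₁ refl = ¬ab (symmetric xy , xy∉ ∘ arcs-swap (steps (u ∷ v ∷ w ∷ rest ∷ʳ u)))
        ... | inj₂ refl | inj₂ refl = irrefl xy
        differ : ∀ {x y} → x ≢ y → Off u x → Off u y → Off v x → ¬ Off v y
        differ x≢y ux uy vx vy with only-ab ux | only-ab uy | only-cd vx | only-cd vy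
        ... | inj₁ refl | _         | inj₁ x≡c | _        = a≢c x≡c
        ... | inj₁ refl | _         | inj₂ x≡d | _        = a≢d x≡d
        ... | inj₂ refl | inj₁ refl | _        | inj₁ y≡c = a≢c y≡c
        ... | inj₂ refl | inj₁ refl | _        | inj₂ y≡d = a≢d y≡d
        ... | inj₂ refl | inj₂ refl | _        | _        = x≢y refl

    -- Here x′ is the neighbour of x outside the K₄ or wheel.
    K₄-distinct-extras : ∀ {p q r s} → p ~ q → p ~ r → p ~ s → q ~ r → q ~ s → r ~ s →
      ∀ {p′ q′ r′ s′} → p ~ p′ → p′ ≢ q → p′ ≢ r → p′ ≢ s → q ~ q′ → q′ ≢ p → q′ ≢ r → q′ ≢ s →
      r ~ r′ → r′ ≢ p → r′ ≢ q → r′ ≢ s → s ~ s′ → s′ ≢ p → s′ ≢ q → s′ ≢ r →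
      p′ ≢ r′ → q′ ≢ s′ → Reducible H
    K₄-distinct-extras {p} {q} {r} {s} pq pr ps qr qs rs {p′} {q′} {r′} {s′}
      pp′ p′≢q p′≢r p′≢s qq′ q′≢p q′≢r q′≢s rr′ r′≢p r′≢q r′≢s ss′ s′≢p s′≢q s′≢r p′≢r′ q′≢s′ =
      -- The cycle `p`, `q`, `r`, `s` leaves `r`, `p′` at `p` and `s`, `q′` at `q`. The only
      -- neighbour of `r` outside the K₄ is `r′`, so `r` and `p′` are non-adjacent; likewise `s` and
      -- `q′`.
      reducible-pairs p q r (s ∷ [])
        ((p≢q ∷ p≢r ∷ p≢s ∷ []) ∷ (q≢r ∷ q≢s ∷ []) ∷ (r≢s ∷ []) ∷ [] ∷ [])
        (pq ∷ qr ∷ rs ∷ symmetric ps ∷ [])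
        r p′ s q′
        (λ { (px , px∉) → case Np px of λ
          { #0 → contradiction #0 px∉ ; #1 → inj₁ refl ; #2 → contradiction #7 px∉ ; #3 → inj₂ refl } })
        (λ { (rp′ , _) → case Nr rp′ of λ
          { #0 → irrefl pp′ ; #1 → p′≢q refl ; #2 → p′≢s refl ; #3 → p′≢r′ refl } })
        (λ { (qx , qx∉) → case Nq qx of λ
          { #0 → contradiction #1 qx∉ ; #1 → contradiction #2 qx∉ ; #2 → inj₁ refl ; #3 → inj₂ refl } })
        (λ { (sq′ , _) → case Ns sq′ of λ
          { #0 → q′≢p refl ; #1 → irrefl qq′ ; #2 → q′≢r refl ; #3 → q′≢s′ refl } })
        r≢s (q′≢r ∘ sym)
      where
      p≢q = adjacent⇒≢ pq
      p≢r = adjacent⇒≢ pr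
      p≢s = adjacent⇒≢ ps
      q≢r = adjacent⇒≢ qr
      q≢s = adjacent⇒≢ qs
      r≢s = adjacent⇒≢ rs
      Np : ∀ {x} → p ~ x → x ∈ q ∷ r ∷ s ∷ p′ ∷ []
      Np = four-neighbours ((q≢r ∷ q≢s ∷ (p′≢q ∘ sym) ∷ []) ∷ (r≢s ∷ (p′≢r ∘ sym) ∷ []) ∷ ((p′≢s ∘ sym) ∷ []) ∷
          [] ∷ [])
             pq pr ps pp′
      Nq : ∀ {x} → q ~ x → x ∈ p ∷ r ∷ s ∷ q′ ∷ []
      Nq = four-neighbours ((p≢r ∷ p≢s ∷ (q′≢p ∘ sym) ∷ []) ∷ (r≢s ∷ (q′≢r ∘ sym) ∷ []) ∷ ((q′≢s ∘ sym) ∷ []) ∷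
          [] ∷ [])
             (symmetric pq) qr qs qq′
      Nr : ∀ {x} → r ~ x → x ∈ p ∷ q ∷ s ∷ r′ ∷ []
      Nr = four-neighbours ((p≢q ∷ p≢s ∷ (r′≢p ∘ sym) ∷ []) ∷ (q≢s ∷ (r′≢q ∘ sym) ∷ []) ∷ ((r′≢s ∘ sym) ∷ []) ∷
          [] ∷ [])
             (symmetric pr) (symmetric qr) rs rr′
      Ns : ∀ {x} → s ~ x → x ∈ p ∷ q ∷ r ∷ s′ ∷ []
      Ns = four-neighbours ((p≢q ∷ p≢r ∷ (s′≢p ∘ sym) ∷ []) ∷ (q≢r ∷ (s′≢q ∘ sym) ∷ []) ∷ ((s′≢r ∘ sym) ∷ []) ∷
          [] ∷ [])
             (symmetric ps) (symmetric qs) (symmetric rs) ss′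

    -- The cycle `p`, `r`, `s`, `q`, `t` leaves `s`, `q` at `p` and `t`, `q` at `r`. It uses the
    -- edges joining `q` to `s` and to `t`, so both pairs are non-adjacent afterwards.
    K₄-common-extra : ∀ {p q r s t} → p ~ q → p ~ r → p ~ s → q ~ r → q ~ s → r ~ s →
      p ~ t → q ~ t → r ~ t → t ≢ s → Reducible H
    K₄-common-extra {p} {q} {r} {s} {t} pq pr ps qr qs rs pt qt rt t≢s =
      reducible-pairs p r s (q ∷ t ∷ [])
        ((p≢r ∷ p≢s ∷ p≢q ∷ p≢t ∷ []) ∷ (r≢s ∷ (q≢r ∘ sym) ∷ r≢t ∷ []) ∷ ((q≢s ∘ sym) ∷ (t≢s ∘ sym) ∷ []) ∷
            (q≢t ∷ []) ∷ [] ∷ [])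
        (pr ∷ rs ∷ symmetric qs ∷ qt ∷ symmetric pt ∷ [])
        s q t q
        (λ { (px , px∉) → case Np px of λ
          { #0 → inj₂ refl ; #1 → contradiction #0 px∉ ; #2 → inj₁ refl ; #3 → contradiction #9 px∉ } })
        (λ { (_ , sq∉) → sq∉ #4 })
        (λ { (rx , rx∉) → case Nr rx of λ
          { #0 → contradiction #1 rx∉ ; #1 → inj₂ refl ; #2 → contradiction #2 rx∉ ; #3 → inj₁ refl } })
        (λ { (_ , tq∉) → tq∉ #7 })
        (t≢s ∘ sym) (q≢s ∘ sym)
      where
      p≢q = adjacent⇒≢ pq
      p≢r = adjacent⇒≢ pr
      p≢s = adjacent⇒≢ ps
      p≢t = adjacent⇒≢ pt
      q≢r = adjacent⇒≢ qr
      q≢s = adjacent⇒≢ qs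
      q≢t = adjacent⇒≢ qt
      r≢s = adjacent⇒≢ rs
      r≢t = adjacent⇒≢ rt
      Np : ∀ {x} → p ~ x → x ∈ q ∷ r ∷ s ∷ t ∷ []
      Np = four-neighbours ((q≢r ∷ q≢s ∷ q≢t ∷ []) ∷ (r≢s ∷ r≢t ∷ []) ∷ ((t≢s ∘ sym) ∷ []) ∷ [] ∷ []) pq pr ps pt
      Nr : ∀ {x} → r ~ x → x ∈ p ∷ q ∷ s ∷ t ∷ []
      Nr = four-neighbours ((p≢q ∷ p≢s ∷ p≢t ∷ []) ∷ (q≢s ∷ q≢t ∷ []) ∷ ((t≢s ∘ sym) ∷ []) ∷ [] ∷ [])
             (symmetric pr) (symmetric qr) rs rt

  -- The cycle `p`, `q`, `r`, `s` works if `p′ ≢ r′` and `q′ ≢ s′`, the cycle `p`, `r`, `q`, `s` if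
  -- `p′ ≢ q′` and `r′ ≢ s′`. If both conditions fail, an equality violating the first and one
  -- violating the second share a letter, so three of the extra neighbours coincide.
  K₄-reducible : ∀ {p q r s} → p ~ q → p ~ r → p ~ s → q ~ r → q ~ s → r ~ s → Reducible H
  K₄-reducible {p} {q} {r} {s} pq pr ps qr qs rs
    with p′ , pp′ , p′≢q , p′≢r , p′≢s ← fourth-neighbour
        ((adjacent⇒≢ qr ∷ adjacent⇒≢ qs ∷ []) ∷ (adjacent⇒≢ rs ∷ []) ∷ [] ∷ []) pq pr ps
    with q′ , qq′ , q′≢p , q′≢r , q′≢s ← fourth-neighbour
        ((adjacent⇒≢ pr ∷ adjacent⇒≢ ps ∷ []) ∷ (adjacent⇒≢ rs ∷ []) ∷ [] ∷ []) (symmetric pq) qr qs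
    with r′ , rr′ , r′≢p , r′≢q , r′≢s ← fourth-neighbour
        ((adjacent⇒≢ pq ∷ adjacent⇒≢ ps ∷ []) ∷ (adjacent⇒≢ qs ∷ []) ∷ [] ∷ []) (symmetric pr) (symmetric qr) rs
    with s′ , ss′ , s′≢p , s′≢q , s′≢r ← fourth-neighbour
        ((adjacent⇒≢ pq ∷ adjacent⇒≢ pr ∷ []) ∷ (adjacent⇒≢ qr ∷ []) ∷ [] ∷ []) (symmetric ps) (symmetric qs)
            (symmetric rs)
    with p′ ≟ r′ | q′ ≟ s′ | p′ ≟ q′ | r′ ≟ s′
  ... | no p′≢r′ | no q′≢s′ | _ | _ = K₄-distinct-extras pq pr ps qr qs rs
        pp′ p′≢q p′≢r p′≢s qq′ q′≢p q′≢r q′≢s rr′ r′≢p r′≢q r′≢s ss′ s′≢p s′≢q s′≢r p′≢r′ q′≢s′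
  ... | _ | _ | no p′≢q′ | no r′≢s′ = K₄-distinct-extras pr pq ps (symmetric qr) rs qs
        pp′ p′≢r p′≢q p′≢s rr′ r′≢p r′≢q r′≢s qq′ q′≢p q′≢r q′≢s ss′ s′≢p s′≢r s′≢q p′≢q′ r′≢s′
  ... | yes refl | _ | yes refl | _ = K₄-common-extra pq pr ps qr qs rs pp′ qq′ rr′ p′≢s
  ... | yes refl | _ | _ | yes refl = K₄-common-extra pr ps pq rs (symmetric qr) (symmetric qs) pp′ rr′ ss′ p′≢q
  ... | _ | yes refl | yes refl | _ = K₄-common-extra pq ps pr qs qr (symmetric rs) pp′ qq′ ss′ p′≢r
  ... | _ | yes refl | _ | yes refl = K₄-common-extra qr qs (symmetric pq) rs (symmetric pr) (symmetric ps) qq′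
      rr′ ss′ q′≢p

  private
    wheel-distinct-extras : ∀ {v u x y z u′ x′} → v ~ u → v ~ x → v ~ y → v ~ z →
      u ~ x → x ~ y → y ~ z → z ~ u → u ≢ y → x ≢ z →
      u ~ u′ → u′ ≢ v → u′ ≢ x → u′ ≢ y → u′ ≢ z → x ~ x′ → x′ ≢ v → x′ ≢ u → x′ ≢ y → x′ ≢ z →
      u′ ≢ x′ → Reducible H
    wheel-distinct-extras {v} {u} {x} {y} {z} {u′} {x′} vu vx vy vz ux xy yz zu u≢y x≢z
      uu′ u′≢v u′≢x u′≢y u′≢z xx′ x′≢v x′≢u x′≢y x′≢z u′≢x′ =
      reducible-pairs u x y (z ∷ [])
        ((u≢x ∷ u≢y ∷ u≢z ∷ []) ∷ (x≢y ∷ x≢z ∷ []) ∷ (adjacent⇒≢ yz ∷ []) ∷ [] ∷ [])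
        (ux ∷ xy ∷ yz ∷ zu ∷ [])
        u′ v x′ v
        (λ { (ua , ua∉) → case Nu ua of λ
          { #0 → inj₂ refl ; #1 → contradiction #0 ua∉ ; #2 → contradiction #7 ua∉ ; #3 → inj₁ refl } })
        (λ { (u′v , _) → case Nv (symmetric u′v) of λ
          { #0 → irrefl uu′ ; #1 → u′≢x refl ; #2 → u′≢y refl ; #3 → u′≢z refl } })
        (λ { (xa , xa∉) → case Nx xa of λ
          { #0 → inj₂ refl ; #1 → contradiction #1 xa∉ ; #2 → contradiction #2 xa∉ ; #3 → inj₁ refl } })
        (λ { (x′v , _) → case Nv (symmetric x′v) of λ
          { #0 → x′≢u refl ; #1 → irrefl xx′ ; #2 → x′≢y refl ; #3 → x′≢z refl } })
        u′≢x′ u′≢v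
      where
      u≢x = adjacent⇒≢ ux
      u≢z = adjacent⇒≢ zu ∘ sym
      x≢y = adjacent⇒≢ xy
      Nv : ∀ {a} → v ~ a → a ∈ u ∷ x ∷ y ∷ z ∷ []
      Nv = four-neighbours ((u≢x ∷ u≢y ∷ u≢z ∷ []) ∷ (x≢y ∷ x≢z ∷ []) ∷ (adjacent⇒≢ yz ∷ []) ∷ [] ∷ []) vu vx vy vz
      Nu : ∀ {a} → u ~ a → a ∈ v ∷ x ∷ z ∷ u′ ∷ []
      Nu = four-neighbours ((adjacent⇒≢ vx ∷ adjacent⇒≢ vz ∷ (u′≢v ∘ sym) ∷ []) ∷ (x≢z ∷ (u′≢x ∘ sym) ∷ []) ∷
          ((u′≢z ∘ sym) ∷ []) ∷ [] ∷ [])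
             (symmetric vu) ux (symmetric zu) uu′
      Nx : ∀ {a} → x ~ a → a ∈ v ∷ u ∷ y ∷ x′ ∷ []
      Nx = four-neighbours ((adjacent⇒≢ vu ∷ adjacent⇒≢ vy ∷ (x′≢v ∘ sym) ∷ []) ∷ (u≢y ∷ (x′≢u ∘ sym) ∷ []) ∷
          ((x′≢y ∘ sym) ∷ []) ∷ [] ∷ [])
             (symmetric vx) (symmetric ux) xy xx′

    -- The six-cycle `u`, `w`, `x`, `v`, `y`, `z` leaves `x`, `v` at `u` and `y`, `z` at `w`, and it
    -- uses the edge joining each of these pairs.
    octahedron-reducible : ∀ {v w u x y z} → v ~ u → v ~ x → v ~ y → v ~ z → w ~ u → w ~ x → w ~ y → w ~ z →
      u ~ x → x ~ y → y ~ z → z ~ u → u ≢ y → x ≢ z → v ≢ w → Reducible H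
    octahedron-reducible {v} {w} {u} {x} {y} {z} vu vx vy vz wu wx wy wz ux xy yz zu u≢y x≢z v≢w =
      reducible-pairs u w x (v ∷ y ∷ z ∷ [])
        ( ((adjacent⇒≢ wu ∘ sym) ∷ u≢x ∷ (adjacent⇒≢ vu ∘ sym) ∷ u≢y ∷ u≢z ∷ [])
        ∷ (adjacent⇒≢ wx ∷ (v≢w ∘ sym) ∷ adjacent⇒≢ wy ∷ adjacent⇒≢ wz ∷ [])
        ∷ ((adjacent⇒≢ vx ∘ sym) ∷ x≢y ∷ x≢z ∷ [])
        ∷ (adjacent⇒≢ vy ∷ adjacent⇒≢ vz ∷ []) ∷ (y≢z ∷ []) ∷ [] ∷ [] )
        (symmetric wu ∷ wx ∷ symmetric vx ∷ vy ∷ yz ∷ zu ∷ [])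
        x v y z
        (λ { (ua , ua∉) → case Nu ua of λ
          { #0 → inj₂ refl ; #1 → contradiction #0 ua∉ ; #2 → inj₁ refl ; #3 → contradiction (there (there #9))
              ua∉ } })
        (λ { (_ , xv∉) → xv∉ #4 })
        (λ { (wa , wa∉) → case Nw wa of λ
          { #0 → contradiction #1 wa∉ ; #1 → contradiction #2 wa∉ ; #2 → inj₁ refl ; #3 → inj₂ refl } })
        (λ { (_ , yz∉) → yz∉ #8 })
        x≢y x≢z
      where
      u≢x = adjacent⇒≢ ux
      u≢z = adjacent⇒≢ zu ∘ sym
      x≢y = adjacent⇒≢ xy
      y≢z = adjacent⇒≢ yz
      Nu : ∀ {a} → u ~ a → a ∈ v ∷ w ∷ x ∷ z ∷ []
      Nu = four-neighbours ((v≢w ∷ adjacent⇒≢ vx ∷ adjacent⇒≢ vz ∷ []) ∷ (adjacent⇒≢ wx ∷ adjacent⇒≢ wz ∷ []) ∷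
          (x≢z ∷ []) ∷ [] ∷ [])
             (symmetric vu) (symmetric wu) ux (symmetric zu)
      Nw : ∀ {a} → w ~ a → a ∈ u ∷ x ∷ y ∷ z ∷ []
      Nw = four-neighbours ((u≢x ∷ u≢y ∷ u≢z ∷ []) ∷ (x≢y ∷ x≢z ∷ []) ∷ (y≢z ∷ []) ∷ [] ∷ []) wu wx wy wz

  -- A chord of the rim yields a K₄ through the hub. Otherwise every rim vertex has a neighbour
  -- outside the wheel: if two consecutive ones differ, the rim is removed, and if all agree, the
  -- wheel extends to an octahedron.
  wheel-reducible : ∀ {v u x y z} → v ~ u → v ~ x → v ~ y → v ~ z →
    u ~ x → x ~ y → y ~ z → z ~ u → u ≢ y → x ≢ z → Reducible H
  wheel-reducible {v} {u} {x} {y} {z} vu vx vy vz ux xy yz zu u≢y x≢z with u ~? y | x ~? z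
  ... | yes uy | _ = K₄-reducible vu vx vy ux uy xy
  ... | _ | yes xz = K₄-reducible vx vy vz xy xz yz
  ... | no ¬uy | no ¬xz
    with u′ , uu′ , u′≢v , u′≢x , u′≢z ← fourth-neighbour
        ((adjacent⇒≢ vx ∷ adjacent⇒≢ vz ∷ []) ∷ (x≢z ∷ []) ∷ [] ∷ []) (symmetric vu) ux (symmetric zu)
    with x′ , xx′ , x′≢v , x′≢u , x′≢y ← fourth-neighbour
        ((adjacent⇒≢ vu ∷ adjacent⇒≢ vy ∷ []) ∷ (u≢y ∷ []) ∷ [] ∷ []) (symmetric vx) (symmetric ux) xy
    with y′ , yy′ , y′≢v , y′≢x , y′≢z ← fourth-neighbour
        ((adjacent⇒≢ vx ∷ adjacent⇒≢ vz ∷ []) ∷ (x≢z ∷ []) ∷ [] ∷ []) (symmetric vy) (symmetric xy) yz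
    with z′ , zz′ , z′≢v , z′≢u , z′≢y ← fourth-neighbour
        ((adjacent⇒≢ vu ∷ adjacent⇒≢ vy ∷ []) ∷ (u≢y ∷ []) ∷ [] ∷ []) (symmetric vz) zu (symmetric yz)
    with u′ ≟ x′ | x′ ≟ y′ | y′ ≟ z′
  ... | no u′≢x′ | _ | _ = wheel-distinct-extras vu vx vy vz ux xy yz zu u≢y x≢z
        uu′ u′≢v u′≢x (λ { refl → ¬uy uu′ }) u′≢z xx′ x′≢v x′≢u x′≢y (λ { refl → ¬xz xx′ }) u′≢x′
  ... | _ | no x′≢y′ | _ = wheel-distinct-extras vx vy vz vu xy yz zu ux x≢z (u≢y ∘ sym)
        xx′ x′≢v x′≢y (λ { refl → ¬xz xx′ }) x′≢u yy′ y′≢v y′≢x y′≢z (λ { refl → ¬uy (symmetric yy′) }) x′≢y′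
  ... | _ | _ | no y′≢z′ = wheel-distinct-extras vy vz vu vx yz zu ux xy (u≢y ∘ sym) (x≢z ∘ sym)
        yy′ y′≢v y′≢z (λ { refl → ¬uy (symmetric yy′) }) y′≢x zz′ z′≢v z′≢y z′≢u
            (λ { refl → ¬xz (symmetric zz′) }) y′≢z′
  ... | yes refl | yes refl | yes refl =
        octahedron-reducible vu vx vy vz (symmetric uu′) (symmetric xx′) (symmetric yy′) (symmetric zz′)
          ux xy yz zu u≢y x≢z (u′≢v ∘ sym)

  -- The greedy walk

  private
    Rest : A → A → A → A → Set
    Rest t u v a = u ~ a × a ≢ t × a ≢ v

    Rest? : ∀ t u v a → Dec (Rest t u v a)
    Rest? t u v a = (u ~? a) ×-dec ¬? (a ≟ t) ×-dec ¬? (a ≟ v)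

    Good : A → A → A → Set
    Good t u v = ∀ {a b} → Rest t u v a → Rest t u v b → ¬ a ~ b

    -- F holds of the unused neighbours of u, or of nothing at the first step.
    record Exit (F : A → Set) (u v : A) : Set where
      constructor exit
      field
        {y}    : A
        vy     : v ~ y
        y≢u    : y ≢ u
        good   : Good u v y
        differ : ∀ {a b} → a ≢ b → Rest u v y a → Rest u v y b → F a → ¬ F b

    module _ (F : A → Set) (F? : ∀ a → Dec (F a)) where

      Bad : A → A → Set
      Bad a b = a ~ b ⊎ (F a × F b)

      bad? : ∀ a b → Dec (Bad a b)
      bad? a b = (a ~? b) ⊎-dec (F? a ×-dec F? b)

      exit-pair : ∀ {u v y a b} → v ~ y → y ≢ u → (∀ {c} → Rest u v y c → c ≡ a ⊎ c ≡ b) → ¬ Bad a b → Exit F u v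
      exit-pair {u} {v} {y} {a} {b} vy y≢u only ¬bad = exit vy y≢u good differ
        where
        good : Good u v y
        good rc rd cd with only rc | only rd
        ... | inj₁ refl | inj₁ refl = irrefl cd
        ... | inj₁ refl | inj₂ refl = ¬bad (inj₁ cd)
        ... | inj₂ refl | inj₁ refl = ¬bad (inj₁ (symmetric cd))
        ... | inj₂ refl | inj₂ refl = irrefl cd
        differ : ∀ {c d} → c ≢ d → Rest u v y c → Rest u v y d → F c → ¬ F d
        differ c≢d rc rd Fc Fd with only rc | only rd
        ... | inj₁ refl | inj₁ refl = c≢d refl
        ... | inj₁ refl | inj₂ refl = ¬bad (inj₂ (Fc , Fd))
        ... | inj₂ refl | inj₁ refl = ¬bad (inj₂ (Fd , Fc))
        ... | inj₂ refl | inj₂ refl = c≢d refl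

      module _ {u v : A} (vu : v ~ u) (F⇒~ : ∀ {a} → F a → u ~ a)
               (≤2F : ∀ {a b c} → Unique (a ∷ b ∷ c ∷ []) → F a → F b → ¬ F c) where

        -- `F` holds of at most two vertices, so at most one of the three pairs is bad through `F`
        -- alone. If none is, `v`, `x`, `y`, `z` form a K₄; if one is, both its members are adjacent
        -- to `u` and to the third vertex, which closes the rim of a wheel with hub `v`.
        all-bad : ∀ {x y z} → Unique (u ∷ x ∷ y ∷ z ∷ []) → v ~ x → v ~ y → v ~ z →
          Bad x y → Bad x z → Bad y z → Reducible H
        all-bad {x} {y} {z} ((u≢x ∷ u≢y ∷ u≢z ∷ []) ∷ uq@((x≢y ∷ x≢z ∷ []) ∷ (y≢z ∷ []) ∷ [] ∷ [])) vx vy vz = go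
          where
          go : Bad x y → Bad x z → Bad y z → Reducible H
          go (inj₁ xy) (inj₁ xz) (inj₁ yz) = K₄-reducible vx vy vz xy xz yz
          go (inj₁ xy) (inj₁ xz) (inj₂ (Fy , Fz)) =
            wheel-reducible vu vy vx vz (F⇒~ Fy) (symmetric xy) xz (symmetric (F⇒~ Fz)) u≢x y≢z
          go (inj₁ xy) (inj₂ (Fx , Fz)) (inj₁ yz) =
            wheel-reducible vu vx vy vz (F⇒~ Fx) xy yz (symmetric (F⇒~ Fz)) u≢y x≢z
          go (inj₂ (Fx , Fy)) (inj₁ xz) (inj₁ yz) =
            wheel-reducible vu vx vz vy (F⇒~ Fx) xz (symmetric yz) (symmetric (F⇒~ Fy)) u≢z x≢y
          go (inj₂ (Fx , Fy)) (inj₂ (_ , Fz)) _ = contradiction Fz (≤2F uq Fx Fy)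
          go (inj₂ (Fx , Fy)) _ (inj₂ (_ , Fz)) = contradiction Fz (≤2F uq Fx Fy)
          go _ (inj₂ (Fx , Fz)) (inj₂ (Fy , _)) = contradiction Fz (≤2F uq Fx Fy)

        find-exit : Reducible H ⊎ Exit F u v
        find-exit with l , p ← ∈⇒↭ vu = go l p
          where
          ↭⇒~ : ∀ {l a} → N v ↭ u ∷ l → a ∈ l → v ~ a
          ↭⇒~ p a∈ = ∈-resp-↭ (↭-sym p) (there a∈)
          go : ∀ l → N v ↭ u ∷ l → Reducible H ⊎ Exit F u v
          go [] p = contradiction (∣⇒≤ (subst (2 ∣_) (↭-length p) (even v))) λ { (s≤s ()) }
          go (y ∷ []) p = inj₂ (exit (↭⇒~ p #0) (λ { refl → head∉tail uq #0 })
              (λ r → ⊥-elim (none r)) (λ _ r → ⊥-elim (none r)))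
            where
            uq = Unique-resp-↭ p (unique v)
            none : ∀ {a} → ¬ Rest u v y a
            none (va , a≢u , a≢y) with ∈-resp-↭ p va
            ... | #0 = a≢u refl
            ... | #1 = a≢y refl
          go (_ ∷ _ ∷ []) p = contradiction (subst (2 ∣_) (↭-length p) (even v)) 2∤3
          go (x ∷ y ∷ z ∷ []) p
            with uq@(u∉xyz ∷ _) ← Unique-resp-↭ p (unique v)
            with bad? x y | bad? x z | bad? y z
          ... | no ¬bad | _ | _ = inj₂ (exit-pair (↭⇒~ p #2) (All.lookup u∉xyz #2 ∘ sym)
                (λ { (vc , c≢u , c≢z) → case ∈-resp-↭ p vc of λ
                  { #0 → contradiction refl c≢u ; #1 → inj₁ refl ; #2 → inj₂ refl ; #3 →
                      contradiction refl c≢z } }) ¬bad)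
          ... | _ | no ¬bad | _ = inj₂ (exit-pair (↭⇒~ p #1) (All.lookup u∉xyz #1 ∘ sym)
                (λ { (vc , c≢u , c≢y) → case ∈-resp-↭ p vc of λ
                  { #0 → contradiction refl c≢u ; #1 → inj₁ refl ; #2 → contradiction refl c≢y ; #3 →
                      inj₂ refl } }) ¬bad)
          ... | _ | _ | no ¬bad = inj₂ (exit-pair (↭⇒~ p #0) (All.lookup u∉xyz #0 ∘ sym)
                (λ { (vc , c≢u , c≢x) → case ∈-resp-↭ p vc of λ
                  { #0 → contradiction refl c≢u ; #1 → contradiction refl c≢x ; #2 → inj₁ refl ; #3 →
                      inj₂ refl } }) ¬bad)
          ... | yes xy | yes xz | yes yz = inj₁ (all-bad uq (↭⇒~ p #0) (↭⇒~ p #1) (↭⇒~ p #2) xy xz yz)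
          go (_ ∷ _ ∷ _ ∷ _ ∷ _) p = contradiction (subst (_≤ 4) (↭-length p) (≤4 v))
              λ { (s≤s (s≤s (s≤s (s≤s ())))) }

    -- `take n` cuts the path off right after the meeting point `y`, so that the edge from `y` to
    -- `v` becomes the last step.
    close : ∀ {y v} x l → y ∈ x ∷ l → All (uncurry _~_) (steps (x ∷ l)) → y ~ v →
      ∃[ n ] (All (uncurry _~_) (steps (x ∷ take n l ∷ʳ v)) × (y , v) ∈ steps (x ∷ take n l ∷ʳ v))
    close x l (here refl) _ yv = 0 , yv ∷ [] , here refl
    close x (z ∷ l) (there y∈) (xz ∷ adj) yv with n , adj′ , yv∈ ← close z l y∈ adj yv =
        suc n , xz ∷ adj′ , there yv∈

    -- The path is listed newest vertex first. Its vertices are distinct and lie in `S`, so it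
    -- cannot outgrow `S`, and `fuel` does not run out before the walk meets itself.
    walk : ∀ {S} → Covers S H → ∀ fuel t u v rest → Unique (v ∷ u ∷ t ∷ rest) →
      v ∷ u ∷ t ∷ rest ⊆ S → All (uncurry _~_) (steps (v ∷ u ∷ t ∷ rest)) → Good t u v →
      length S < fuel + length (v ∷ u ∷ t ∷ rest) → Reducible H
    walk cov zero t u v rest uq path⊆S adj good S< = contradiction (unique-⊆⇒length≤ uq path⊆S) (ℕ.<⇒≱ S<)
    walk {S} cov (suc fuel) t u v rest uq path⊆S adj@(vu ∷ ut ∷ adj′) good S<
      with find-exit (Rest t u v) (Rest? t u v) vu proj₁ ≤2
      where
      ≤2 : ∀ {a b c} → Unique (a ∷ b ∷ c ∷ []) → Rest t u v a → Rest t u v b → ¬ Rest t u v c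
      ≤2 {a} {b} {c} uabc (ua , a≢t , a≢v) (ub , b≢t , b≢v) (uc , c≢t , c≢v) =
        contradiction (ℕ.≤-trans (unique-⊆⇒length≤ {xs = v ∷ t ∷ a ∷ b ∷ c ∷ []}
          (  ((λ { refl → head∉tail uq #1 }) ∷ (a≢v ∘ sym) ∷ (b≢v ∘ sym) ∷ (c≢v ∘ sym) ∷ [])
          ∷ ((a≢t ∘ sym) ∷ (b≢t ∘ sym) ∷ (c≢t ∘ sym) ∷ []) ∷ uabc)
          λ { #0 → symmetric vu ; #1 → ut ; #2 → ua ; #3 → ub ; #4 → uc }) (≤4 u))
          λ { (s≤s (s≤s (s≤s (s≤s ())))) }
    ... | inj₁ red = red
    ... | inj₂ (exit {y} vy y≢u good′ differ) with y ∈? (v ∷ u ∷ t ∷ rest)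
    ...   | no y∉ = walk cov fuel u v y (t ∷ rest) (∉⇒All≢ y∉ ∷ uq)
              (λ { (here refl) → cov (symmetric vy) ; (there a∈) → path⊆S a∈ })
              (symmetric vy ∷ adj) good′ (subst (length S <_) (sym (ℕ.+-suc fuel _)) S<)
    ...   | yes (here refl) = contradiction vy irrefl
    ...   | yes (there (here refl)) = contradiction refl y≢u
    -- The walk meets itself, and the cycle runs from `v` back along the path to `y`. Here `v` and
    -- `u` take the roles of `u` and `v` in `Reducible`; what the cycle leaves at them lies in
    -- `Rest u v y` and `Rest t u v`.
    ...   | yes (there (there y∈)) with n , adj″ , yv∈ ← close t rest y∈ adj′ (symmetric vy) = record
            { rest     = take n rest
            ; distinct = Unique.take⁺ (3 + n) uq
            ; adjacent = arcs-adjacent (vu ∷ ut ∷ adj″)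
            ; apart-u  = λ va vb (ab , _) → good′ (rest-v va) (rest-v vb) ab
            ; apart-v  = λ ua ub (ab , _) → good (rest-u ua) (rest-u ub) ab
            ; differ   = λ a≢b va vb ua ub → differ a≢b (rest-v va) (rest-v vb) (rest-u ua) (rest-u ub)
            }
      where
      cycle = steps (v ∷ u ∷ t ∷ take n rest ∷ʳ v)
      rest-v : ∀ {a} → v ~ a × (v , a) ∉ arcs cycle → Rest u v y a
      rest-v (va , va∉) = va , (λ { refl → va∉ #0 })
        , λ { refl → va∉ (arcs-swap cycle (∈-arcs⁺ cycle (there (there yv∈)))) }
      rest-u : ∀ {a} → u ~ a × (u , a) ∉ arcs cycle → Rest t u v a
      rest-u (ua , ua∉) = ua , (λ { refl → ua∉ #2 }) , λ { refl → ua∉ #1 }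

  reducible : ∀ {S} → Covers S H → ∀ {t u} → t ~ u → Reducible H
  reducible {S} cov {t} {u} tu with find-exit (λ _ → ⊥) (λ _ → no λ ()) (symmetric tu) (λ ()) (λ _ ())
  ... | inj₁ red = red
  ... | inj₂ (exit {v} uv v≢t good _) = walk cov (length S) t u v []
    ( ((adjacent⇒≢ uv ∘ sym) ∷ v≢t ∷ []) ∷ ((adjacent⇒≢ tu ∘ sym) ∷ []) ∷ [] ∷ [] )
    (λ { #0 → cov (symmetric uv) ; #1 → cov uv ; #2 → cov tu })
    (symmetric uv ∷ symmetric tu ∷ []) good (ℕ.m<m+n _ (s≤s z≤n))

-- Induction on the number of vertices

empty? : (l : List A) → Dec (l ≡ [])
empty? []      = yes refl
empty? (_ ∷ _) = no λ ()

nonempty⇒∈ : {l : List A} → l ≢ [] → ∃[ x ] x ∈ l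
nonempty⇒∈ {l = []}    l≢[] = contradiction refl l≢[]
nonempty⇒∈ {l = x ∷ _} _    = x , here refl

-- Because subtraction is truncated, `1 ≤ m` matters: with `m = 0` and `n = 2` both bounds are 0.
half-step : ∀ {k m n} → k ≤ ⌊ m ∸ 1 /2⌋ → 1 ≤ m → 2 + m ≤ n → suc k ≤ ⌊ n ∸ 1 /2⌋
half-step k≤ (s≤s z≤n) (s≤s (s≤s (s≤s m≤n))) = s≤s (ℕ.≤-trans k≤ (ℕ.⌊n/2⌋-mono m≤n))

module _ {A : Set} (_≟_ : DecidableEquality A) where

  -- `n` bounds the length of `S` and makes the recursion structural. A graph without edges has the
  -- empty decomposition; any other graph gives up one cycle and two entries of `S`.
  decompose : ∀ n (H : QuarticGraph A) S → length S ≤ n → Covers S H →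
    ∃[ Cs ] (Decomposes H Cs × length Cs ≤ ⌊ length S ∸ 1 /2⌋)
  decompose n H S ≤n cov with All.all? (λ x → empty? (QuarticGraph.N H x)) S
  ... | yes empty = [] , record
    { cyclic = [] ; unique-edges = [] ; sound = λ ()
    ; complete = λ y∈ → case subst (_ ∈_) (All.lookup empty (cov y∈)) y∈ of λ () } , z≤n
  ... | no nonempty
    with x , _ , Nx≢[] ← find (¬All⇒Any¬ (λ x → empty? (QuarticGraph.N H x)) S nonempty)
    with _ , y∈Nx ← nonempty⇒∈ Nx≢[]
    with n | reduce _≟_ cov (reducible _≟_ H cov y∈Nx)
  ...   | zero  | R = contradiction (ℕ.≤-trans (Reduction.smaller R) ≤n) λ ()
  ...   | suc n | R
    with Cs , D , Cs≤ ← decompose n (Reduction.H′ R) (Reduction.S′ R)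
                          (ℕ.≤-pred (ℕ.≤-trans (ℕ.n≤1+n _) (ℕ.≤-trans (Reduction.smaller R) ≤n)))
                          (Reduction.covers R)
    with Cs′ , l , D′ ← Reduction.lift R D =
    Cs′ , D′ , subst (_≤ _) (sym l) (half-step Cs≤ (Reduction.nonempty R) (Reduction.smaller R))

-- Finite search for a minimum

unique-++⁻ : ∀ xs {ys : List A} → Unique (xs ++ ys) → (∀ {x} → x ∈ xs → x ∉ ys) × Unique ys
unique-++⁻ []       uys = (λ ()) , uys
unique-++⁻ (x ∷ xs) u@(_ ∷ u′) with disjoint , uys ← unique-++⁻ xs u′ =
  (λ { (here refl) y∈ → head∉tail u (∈-++⁺ʳ xs y∈) ; (there x∈) → disjoint x∈ }) , uys

lists≤ : ℕ → List A → List (List A)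
lists≤ zero    xs = [ [] ]
lists≤ (suc n) xs = [] ∷ cartesianProductWith _∷_ xs (lists≤ n xs)

∈-lists≤ : ∀ {n} {xs l : List A} → length l ≤ n → All (_∈ xs) l → l ∈ lists≤ n xs
∈-lists≤ {n = zero}  {l = []}    _         _           = here refl
∈-lists≤ {n = suc n} {l = []}    _         _           = here refl
∈-lists≤ {n = suc n} {l = _ ∷ _} (s≤s l≤n) (x∈ ∷ l⊆xs) =
  there (∈-cartesianProductWith⁺ _∷_ x∈ (∈-lists≤ l≤n l⊆xs))

-- It suffices to search the lists over `universe` that are no longer than the given `l`, and these
-- are finitely many; `l` itself is the default of `argmin`.
shortest : {P : List A → Set} → (∀ l → Dec (P l)) → (universe : List A) → (∀ l → P l → All (_∈ universe) l) →
  ∀ l → P l → ∃[ m ] (P m × length m ≤ length l × (∀ l′ → P l′ → length m ≤ length l′))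
shortest {P = P} P? universe within l Pl =
    m , argmin-all length Pl (all-filter P? (lists≤ (length l) universe)) , f[argmin]≤f[⊤] {f = length} l
        candidates , minimal
  where
  candidates = filter P? (lists≤ (length l) universe)
  m = argmin length l candidates
  minimal : ∀ l′ → P l′ → length m ≤ length l′
  minimal l′ Pl′ with length l′ ℕ.≤? length l
  ... | yes l′≤l = All.lookup (f[argmin]≤f[xs] {f = length} l candidates)
      (∈-filter⁺ P? (∈-lists≤ l′≤l (within l′ Pl′)) Pl′)
  ... | no  l′≰l = ℕ.≤-trans (f[argmin]≤f[⊤] {f = length} l candidates) (ℕ.<⇒≤ (ℕ.≰⇒> l′≰l))

-- Transfer between vertex lists and `Graph`

module _ {v : ℕ} (G : Graph v) where

  open Graph G using (Adj; adj?)
  open DecMembership (≡-dec (Fin._≟_ {v}) (Fin._≟_ {v})) using () renaming (_∈?_ to _∈²?_)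

  -- Two cycles with the same vertices need not be equal as records, so the finite search for a
  -- minimal decomposition runs over bare vertex lists.
  private
    HasEdgeᴸ : Fin v → Fin v → List (Fin v) → Set
    HasEdgeᴸ x y C = (x , y) ∈ cyclicPairs C ⊎ (y , x) ∈ cyclicPairs C

    hasEdgeᴸ? : ∀ x y C → Dec (HasEdgeᴸ x y C)
    hasEdgeᴸ? x y C = ((x , y) ∈²? cyclicPairs C) ⊎-dec ((y , x) ∈²? cyclicPairs C)

    IsCycleᴸ : List (Fin v) → Set
    IsCycleᴸ C = IsCyclicList C × All (uncurry Adj) (cyclicPairs C)

    Disjointᴸ : List (Fin v) → List (Fin v) → Set
    Disjointᴸ C D = ∀ x y → HasEdgeᴸ x y C → ¬ HasEdgeᴸ x y D

    IsDecompositionᴸ : List (List (Fin v)) → Set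
    IsDecompositionᴸ Cs = All IsCycleᴸ Cs × AllPairs Disjointᴸ Cs × (∀ x y → Adj x y → Any (HasEdgeᴸ x y) Cs)

    isDecompositionᴸ? : ∀ Cs → Dec (IsDecompositionᴸ Cs)
    isDecompositionᴸ? Cs =
      All.all? (λ C → (AllPairs.allPairs? (λ x y → ¬? (x Fin.≟ y)) C ×-dec 3 ℕ.≤? length C)
                      ×-dec All.all? (λ (x , y) → adj? x y) (cyclicPairs C)) Cs
      ×-dec AllPairs.allPairs? (λ C D → Fin.all? λ x → Fin.all? λ y → hasEdgeᴸ? x y C →-dec ¬? (hasEdgeᴸ? x y D)) Cs
      ×-dec Fin.all? λ x → Fin.all? λ y → adj? x y →-dec Any.any? (hasEdgeᴸ? x y) Cs

    -- A cycle has distinct vertices, hence at most `v` of them, so the candidates form a finite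
    -- list.
    cyclesᴸ : ∀ Cs → IsDecompositionᴸ Cs → All (_∈ lists≤ v (allFin v)) Cs
    cyclesᴸ Cs (cycles , _) = All.map (λ ((u , _) , _) →
      ∈-lists≤ (ℕ.≤-trans (unique-⊆⇒length≤ u λ {x} _ → ∈-allFin x) (ℕ.≤-reflexive (length-tabulate id)))
               (All.universal ∈-allFin _)) cycles

    toCycles : ∀ {Cs} → All IsCycleᴸ Cs → ∃[ Ds ] map (Cycle.vertices {G = G}) Ds ≡ Cs
    toCycles [] = [] , refl
    toCycles (((u , 3≤) , adj) ∷ cs) = Product.map (C ∷_) (cong (_ ∷_)) (toCycles cs)
      where
      C : Cycle G
      C = record { vertices = _ ; distinct = u ; length≥3 = 3≤ ; adjacent = adj }

    toDecomposition : ∀ {Cs} → IsDecompositionᴸ Cs → ∃[ Ds ] (IsCycleDecomposition G Ds × length Ds ≡ length Cs)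
    toDecomposition (cycles , disjoint , covers) with Ds , eq ← toCycles cycles = Ds
      , record { disjoint = AllPairs.map⁻ (subst (AllPairs Disjointᴸ) (sym eq) disjoint)
               ; covers   = λ x y xy → Any.map⁻ (subst (Any (HasEdgeᴸ x y)) (sym eq) (covers x y xy)) }
      , trans (sym (length-map Cycle.vertices Ds)) (cong length eq)

    fromDecomposition : ∀ {Ds} → IsCycleDecomposition G Ds → IsDecompositionᴸ (map Cycle.vertices Ds)
    fromDecomposition {Ds} dec =
        All.map⁺ {f = Cycle.vertices} (All.universal
            (λ C → (Cycle.distinct C , Cycle.length≥3 C) , Cycle.adjacent C) Ds)
      , AllPairs.map⁺ {f = Cycle.vertices} disjoint
      , λ x y xy → Any.map⁺ {f = Cycle.vertices} (covers x y xy)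
      where open IsCycleDecomposition dec

  -- Decompositions translate between vertex lists and `Cycle` records in both directions without
  -- changing their size, so a minimum over the former is one over the latter.
  cn-exists : ∀ {Cs} → IsDecompositionᴸ Cs → ∃[ k ] (IsCn G k × k ≤ length Cs)
  cn-exists {Cs} D
    with m , Dm , m≤ , minimal ← shortest isDecompositionᴸ? (lists≤ v (allFin v)) cyclesᴸ Cs D
    with Ds , dec , eq ← toDecomposition Dm = length m , record
      { attained = Ds , dec , eq
      ; minimal  = λ Es dec′ → subst (length m ≤_) (length-map Cycle.vertices Es)
          (minimal _ (fromDecomposition dec′))
      } , m≤

  module _ (eulerian : Eulerian G) (deg≤4 : MaxDegree≤ G 4) where

    quartic : QuarticGraph (Fin v)
    quartic = record
      { N         = λ x → filter (adj? x) (allFin v)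
      ; symmetric = λ y∈ → ∈-filter⁺ (adj? _) (∈-allFin _)
          (Graph.sym G (proj₂ (∈-filter⁻ (adj? _) {xs = allFin v} y∈)))
      ; irrefl    = λ x∈ → Graph.irrefl G refl (proj₂ (∈-filter⁻ (adj? _) {xs = allFin v} x∈))
      ; unique    = λ x → Unique.filter⁺ (adj? x) (Unique.allFin⁺ v)
      ; even      = eulerian
      ; ≤4        = deg≤4
      }

    nonIsolated : List (Fin v)
    nonIsolated = filter (λ x → ¬? (isolated? G x)) (allFin v)

    nonIsolated-covers : Covers nonIsolated quartic
    nonIsolated-covers y∈ = ∈-filter⁺ _ (∈-allFin _) λ isolated → ℕ.<⇒≢ (∈-length y∈) (sym isolated)

    isDecompositionᴸ : ∀ {Cs} → Decomposes quartic Cs → IsDecompositionᴸ Cs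
    isDecompositionᴸ {Cs} D =
        All.tabulate (λ {C} C∈ → All.lookup cyclic C∈ , All.tabulate λ e∈ →
          proj₂ (∈-filter⁻ (adj? _) {xs = allFin v}
              (sound (∈-arcs⁺ (edges Cs) (∈-concatMap⁺ cyclicPairs (lose C∈ e∈))))))
      , disjoint Cs unique-edges
      , λ x y xy → covered (∈-arcs⁻ (edges Cs) (complete (∈-filter⁺ (adj? x) (∈-allFin y) xy)))
      where
      open Decomposes D
      covered : ∀ {x y} → (x , y) ∈ edges Cs ⊎ (y , x) ∈ edges Cs → Any (HasEdgeᴸ x y) Cs
      covered (inj₁ xy) = Any.map inj₁ (∈-concatMap⁻ cyclicPairs {xs = Cs} xy)
      covered (inj₂ yx) = Any.map inj₂ (∈-concatMap⁻ cyclicPairs {xs = Cs} yx)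
      arcs-edge : ∀ {x y} C → HasEdgeᴸ x y C → (x , y) ∈ arcs (cyclicPairs C)
      arcs-edge C (inj₁ xy) = ∈-arcs⁺ (cyclicPairs C) xy
      arcs-edge C (inj₂ yx) = arcs-swap (cyclicPairs C) (∈-arcs⁺ (cyclicPairs C) yx)
      arcs-edges : ∀ {x y} {D} {Ds} → D ∈ Ds → HasEdgeᴸ x y D → (x , y) ∈ arcs (edges Ds)
      arcs-edges {Ds = Ds} D∈ (inj₁ xy) = ∈-arcs⁺ (edges Ds) (∈-concatMap⁺ cyclicPairs (lose D∈ xy))
      arcs-edges {Ds = Ds} D∈ (inj₂ yx) =
        arcs-swap (edges Ds) (∈-arcs⁺ (edges Ds) (∈-concatMap⁺ cyclicPairs (lose D∈ yx)))
      -- An edge common to two cycles, in whatever orientation, would occur twice among the arcs.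
      disjoint : ∀ Ds → Unique (arcs (edges Ds)) → AllPairs Disjointᴸ Ds
      disjoint [] _ = []
      disjoint (C ∷ Ds) u
        with apart , u′ ← unique-++⁻ (arcs (cyclicPairs C)) (subst Unique (arcs-++ (cyclicPairs C) (edges Ds)) u) =
          All.tabulate (λ D∈ x y xyC xyD → apart (arcs-edge C xyC) (arcs-edges D∈ xyD)) ∷ disjoint Ds u′

theorem4p4 : ∀ (v : ℕ) (G : Graph v) →
    Eulerian G →
    1 ≤ #nonIsolated G →
    MaxDegree≤ G 4 →
    ∃[ k ] (IsCn G k × k ≤ ⌊ #nonIsolated G ∸ 1 /2⌋)
theorem4p4 v G eulerian _ deg≤4
  with Cs , D , Cs≤ ← decompose Fin._≟_ _ (quartic G eulerian deg≤4) (nonIsolated G eulerian deg≤4)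
                        ℕ.≤-refl (nonIsolated-covers G eulerian deg≤4)
  with k , cn , k≤ ← cn-exists G (isDecompositionᴸ G eulerian deg≤4 D) = k , cn , ℕ.≤-trans k≤ Cs≤
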